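{- Let $\Lambda_0$ be a (finite or countable) biconnected graph. Let $H\le\mathrm{Aut}(\Lambda_0)$, let $\{Q_j : j\in\mathbb{J}\}$ be the set of orbits of $H$ on $V\Lambda_0$, and let $\{R_k : k\in\mathbb{K}\}$ be a partition of $V\Lambda_0$ such that each $Q_j$ is contained in some $R_k$. For each $k\in\mathbb{K}$ let $\mu_k:\mathbb{J}\to\mathbb{N}\cup\{0,\aleph_0\}$ be a function with $\mu_k(j)>0$ if and only if $Q_j\subseteq R_k$, and suppose $\sum_{j\in\mathbb{J}}\mu_k(j)\ge 2$ for at least one $k\in\mathbb{K}$. Then there exists, unique up to isomorphism, a lobe-transitive graph $\Gamma$ of connectivity $1$ together with isomorphisms $\sigma_\Lambda:\Lambda_0\to\Lambda$ for every lobe $\Lambda\in\mathscr{L}(\Gamma)$ such that for each vertex $v\in V\Gamma$ there is $k\in\mathbb{K}$ with $$\mu_k(j)=\bigl|\{\Lambda\in\mathscr{L}(\Gamma): \sigma_\Lambda^{ -1}(v)\in Q_j\}\bigr|\quad\text{for all } j\in\mathbb{J}.$$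
   Context: All graphs are simple, connected, and finite or countably infinite. For edges $e_1,e_2$ of a graph $\Gamma$ write $e_1\cong e_2$ if $e_1=e_2$ or they lie on a common cycle; a lobe of $\Gamma$ is the subgraph induced by an equivalence class of this relation (a cut-edge with its ends, or a maximal biconnected subgraph). $\mathscr{L}(\Gamma)$ is the set of lobes. A connected graph other than $K_2$ has connectivity $1$ iff some vertex lies in at least two lobes. $\Gamma$ is lobe-transitive if $\mathrm{Aut}(\Gamma)$ acts transitively on $\mathscr{L}(\Gamma)$. $\mathbb{N}$ denotes the positive integers. -}

module Defs where

open import Data.Fin using (Fin; toℕ)
open import Data.Nat using (ℕ; suc; _+_)
open import Data.Nat.DivMod using (_mod_)
open import Data.Product using (Σ-syntax; ∃-syntax; _×_; _,_; proj₁)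
open import Data.Refinement using (Refinement-syntax; value; _,_)
open import Data.Sum using (_⊎_; inj₁; inj₂; swap)
open import Function.Base using (_∘_)
open import Function.Bundles using (_↔_; _⇔_; Inverse; Equivalence; mk⇔)
open import Function.Construct.Composition using (_↔-∘_; _⇔-∘_)
open import Function.Construct.Identity using (↔-id; ⇔-id)
open import Function.Construct.Symmetry using (↔-sym)
open import Function.Definitions using (Injective)
open import Level using (0ℓ)
open import Relation.Binary.Bundles using (Setoid)
open import Relation.Binary.Construct.Closure.ReflexiveTransitive using (Star)
import Relation.Binary.Construct.On as On
open import Relation.Binary.PropositionalEquality
  using (_≡_; _≢_; _≗_; refl; sym; subst₂; setoid)
open import Relation.Nullary using (¬_)
open import Relation.Unary using (Pred; _≐_; _∈_)
open import Relation.Unary.Relation.Binary.Equality using (≐-setoid)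

data Cardinal : Set where
  fin : ℕ → Cardinal
  ℵ₀  : Cardinal

⟦_⟧ : Cardinal → Set
⟦ fin n ⟧ = Fin n
⟦ ℵ₀ ⟧    = ℕ

HasCardinality : Setoid 0ℓ 0ℓ → Cardinal → Set
HasCardinality S κ = Inverse (setoid ⟦ κ ⟧) S

-- Connectedness and countability are separate predicates, so that arbitrary
-- subgraphs are again of type Graph.
record Graph : Set₁ where
  field
    V       : Set
    Adj     : V → V → Set
    Adj-sym : ∀ {x y} → Adj x y → Adj y x
    Adj-irr : ∀ {x} → ¬ Adj x x

open Graph public

Countable : Graph → Set
Countable Γ = ∃[ κ ] HasCardinality (setoid (V Γ)) κ

Connected : Graph → Set
Connected Γ = ∀ x y → Star (Adj Γ) x y

NonTrivial : Graph → Set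
NonTrivial Γ = Σ[ x ∈ V Γ ] Σ[ y ∈ V Γ ] x ≢ y

_-_ : (Γ : Graph) → V Γ → Graph
Γ - v = record
  { V       = [ x ∈ V Γ ∣ x ≢ v ]
  ; Adj     = λ x y → Adj Γ (value x) (value y)
  ; Adj-sym = Adj-sym Γ
  ; Adj-irr = Adj-irr Γ
  }

-- Connected without cut vertices.  K₁ is excluded, having no edges and hence
-- no lobe; K₂, which can occur as a lobe, is included.
Biconnected : Graph → Set
Biconnected Γ = NonTrivial Γ × Connected Γ × (∀ v → Connected (Γ - v))

-- Deleting some one vertex, but not the empty set of vertices, leaves a graph
-- that is disconnected or has a single vertex.
HasConnectivity1 : Graph → Set
HasConnectivity1 Γ =
  NonTrivial Γ × Connected Γ ×
  (∃[ v ] ¬ (NonTrivial (Γ - v) × Connected (Γ - v)))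

infix 4 _≃_

record _≃_ (Γ Δ : Graph) : Set where
  field
    bij : V Γ ↔ V Δ

  open Inverse bij public using (to; from; strictlyInverseˡ; strictlyInverseʳ)

  field
    adj : ∀ {x y} → Adj Γ x y ⇔ Adj Δ (to x) (to y)

open _≃_ public using (to; from)

Aut : Graph → Set
Aut Γ = Γ ≃ Γ

idᴬ : ∀ {Γ} → Aut Γ
idᴬ = record { bij = ↔-id _ ; adj = ⇔-id _ }

_∘ᴬ_ : ∀ {Γ} → Aut Γ → Aut Γ → Aut Γ
g ∘ᴬ f = record
  { bij = _≃_.bij g ↔-∘ _≃_.bij f
  ; adj = _≃_.adj g ⇔-∘ _≃_.adj f
  }

_⁻¹ᴬ : ∀ {Γ} → Aut Γ → Aut Γ
_⁻¹ᴬ {Γ} f = record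
  { bij = ↔-sym (_≃_.bij f)
  ; adj = λ {x} {y} → mk⇔
      (λ a → Equivalence.from (_≃_.adj f)
               (subst₂ (Adj Γ) (sym (_≃_.strictlyInverseˡ f x))
                               (sym (_≃_.strictlyInverseˡ f y)) a))
      (λ a → subst₂ (Adj Γ) (_≃_.strictlyInverseˡ f x)
                            (_≃_.strictlyInverseˡ f y)
                            (Equivalence.to (_≃_.adj f) a))
  }

-- Automorphisms are equal when they agree on vertices, hence `resp`.
record IsSubgroup {Γ : Graph} (H : Pred (Aut Γ) 0ℓ) : Set where
  field
    resp : ∀ {f g} → to f ≗ to g → f ∈ H → g ∈ H
    id∈  : idᴬ ∈ H
    ∘∈   : ∀ {f g} → g ∈ H → f ∈ H → (g ∘ᴬ f) ∈ H
    ⁻¹∈  : ∀ {f} → f ∈ H → (f ⁻¹ᴬ) ∈ H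

Orbit : {Γ : Graph} → Pred (Aut Γ) 0ℓ → V Γ → Pred (V Γ) 0ℓ
Orbit H v w = ∃[ h ] h ∈ H × to h v ≡ w

-- Q indexes the set of orbits without repetition.
record IsOrbitFamily {Γ : Graph} (H : Pred (Aut Γ) 0ℓ)
                     {J : Set} (Q : J → Pred (V Γ) 0ℓ) : Set where
  field
    isOrbit    : ∀ j → ∃[ v ] Q j ≐ Orbit H v
    everyOrbit : ∀ v → ∃[ j ] Q j ≐ Orbit H v
    distinct   : ∀ {i j} → Q i ≐ Q j → i ≡ j

record IsPartition {A K : Set} (R : K → Pred A 0ℓ) : Set where
  field
    nonempty : ∀ k → ∃[ x ] x ∈ R k
    covers   : ∀ x → ∃[ k ] x ∈ R k
    disjoint : ∀ {k l x} → x ∈ R k → x ∈ R l → k ≡ l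

-- An edge is given by an ordering of its ends; everything below is
-- insensitive to this ordering and to the proof of adjacency.
record Edge (Γ : Graph) : Set where
  field
    src tgt : V Γ
    isAdj   : Adj Γ src tgt

open Edge public

Joins : ∀ {Γ} → Edge Γ → V Γ → V Γ → Set
Joins e x y = (src e ≡ x × tgt e ≡ y) ⊎ (src e ≡ y × tgt e ≡ x)

record Cycle (Γ : Graph) : Set where
  field
    n         : ℕ
    vertex    : Fin (3 + n) → V Γ
    injective : Injective _≡_ _≡_ vertex

  next : Fin (3 + n) → Fin (3 + n)
  next i = suc (toℕ i) mod (3 + n)

  field
    edge : ∀ i → Adj Γ (vertex i) (vertex (next i))

_onCycle_ : ∀ {Γ} → Edge Γ → Cycle Γ → Set
e onCycle c = ∃[ i ] Joins e (vertex i) (vertex (next i))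
  where open Cycle c

infix 4 _≅_

_≅_ : ∀ {Γ} → Edge Γ → Edge Γ → Set
e ≅ f = Joins e (src f) (tgt f) ⊎ (∃[ c ] e onCycle c × f onCycle c)

-- The set of lobes: an edge e stands for the lobe induced by the class of e,
-- and two edges are equal as lobes when their classes coincide.
ℒ : Graph → Setoid 0ℓ 0ℓ
ℒ Γ = On.setoid (≐-setoid (Edge Γ) 0ℓ) (λ e → e ≅_)

Lobe : Graph → Set
Lobe Γ = Setoid.Carrier (ℒ Γ)

induced : (Γ : Graph) → Pred (Edge Γ) 0ℓ → Graph
induced Γ E = record
  { V       = [ x ∈ V Γ ∣ (∃[ e ] e ∈ E × (src e ≡ x ⊎ tgt e ≡ x)) ]
  ; Adj     = λ x y → ∃[ e ] e ∈ E × Joins e (value x) (value y)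
  ; Adj-sym = λ (e , e∈E , j) → e , e∈E , swap j
  ; Adj-irr = λ where
      (e , _ , inj₁ (refl , p)) → loopless e p
      (e , _ , inj₂ (refl , p)) → loopless e p
  }
  where
  loopless : (e : Edge Γ) → ¬ (tgt e ≡ src e)
  loopless record { isAdj = a } refl = Adj-irr Γ a

lobeGraph : (Γ : Graph) → Lobe Γ → Graph
lobeGraph Γ Λ = induced Γ (Λ ≅_)

mapEdge : ∀ {Γ} → Aut Γ → Edge Γ → Edge Γ
mapEdge φ e = record
  { src   = to φ (src e)
  ; tgt   = to φ (tgt e)
  ; isAdj = Equivalence.to (_≃_.adj φ) (isAdj e)
  }

-- An automorphism sends the class of e to the class of its image.
LobeTransitive : Graph → Set
LobeTransitive Γ = (Λ Λ′ : Lobe Γ) → Σ[ φ ∈ Aut Γ ] mapEdge φ Λ ≈ Λ′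
  where open Setoid (ℒ Γ)

-- `resp` says that the isomorphism depends only on the lobe and not on the
-- edge representing it.
record LobeIsos (Λ₀ Γ : Graph) : Set where
  open Setoid (ℒ Γ)
  field
    iso  : (Λ : Lobe Γ) → Λ₀ ≃ lobeGraph Γ Λ
    resp : ∀ {Λ Λ′} → Λ ≈ Λ′ → value ∘ to (iso Λ) ≗ value ∘ to (iso Λ′)

-- The lobes Λ that contain v and satisfy σ_Λ⁻¹(v) ∈ P.
lobesAt : ∀ {Λ₀ Γ} → LobeIsos Λ₀ Γ → V Γ → Pred (V Λ₀) 0ℓ → Setoid 0ℓ 0ℓ
lobesAt {Γ = Γ} σ v P = On.setoid (ℒ Γ) member
  where
  member : (Σ[ Λ ∈ Lobe Γ ] ∃[ u ] u ∈ P × value (to (LobeIsos.iso σ Λ) u) ≡ v)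
         → Lobe Γ
  member = proj₁

{-# OPTIONS --safe #-}
module Submission where

-- Call two edges unseparated if for every vertex v their ends other than v are
-- connected in Γ − v.  This is an equivalence relation, and by rerouting a
-- simple path it agrees with lying on a common cycle; hence two lobes that
-- meet at x and are joined in Γ − x coincide.  Γ is realised by a tree T of
-- copies of Λ₀, in which every vertex carries the copies prescribed by μ.  Any
-- Γ with the required local structure, and any lobe M₀ of it, receives a map
-- from T taking the base copy to M₀: cross a vertex by matching slots, and
-- correct the chart of the next lobe by an element of H.  The map is onto by
-- connectedness and one-to-one because each attaching vertex separates what
-- hangs from it from M₀.  Hence uniqueness; and with Γ = T and M₀ varying,
-- lobe-transitivity.

open import Defs
open import Axiom.ExcludedMiddle using (ExcludedMiddle)
open import Data.Empty using (⊥; ⊥-elim; ⊥-elim-irr)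
open import Data.Fin using (Fin; fromℕ; fromℕ<; inject₁; suc; toℕ; zero)
open import Data.Fin.Properties
  using (toℕ-fromℕ; toℕ-fromℕ<; toℕ-injective; toℕ-inject₁; toℕ<n)
open import Data.Fin.Relation.Unary.Top using (view; ‵fromℕ; ‵inject₁)
open import Data.Irrelevant using ([_])
open import Data.Nat using (_+_; _<_; _∸_; _≤_; suc; s≤s; zero; z≤n; ℕ)
open import Data.Nat.DivMod using (_mod_; m%n<n; m<n⇒m%n≡m; n%n≡0)
open import Data.Nat.Properties
  using (+-suc; <-cmp; <-irrefl; <-trans; <-≤-trans; m∸n+n≡m; m≤n+m; m≤n⇒m<n∨m≡n;
         n<1+n; n≤1+n; suc-injective; ≤-<-trans; ≤-pred; ≤-refl; ≤-trans; ≰⇒>)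
open import Data.Product using (_,_; _×_; proj₁; proj₂; Σ-syntax; ∃!; ∃-syntax)
open import Data.Refinement using (_,_; value; value-injective)
open import Data.Sum as Sum using ([_,_]′; _⊎_; inj₁; inj₂)
open import Data.Unit using (tt; ⊤)
open import Function.Base using (_∘_; id)
open import Function.Bundles using (Equivalence; Injection; Inverse; _↣_; _⇔_; mk⇔)
open import Function.Construct.Composition using (_↔-∘_; _⇔-∘_)
open import Function.Construct.Symmetry using (↔-sym)
open import Function.Definitions using (Injective)
open import Level using (0ℓ)
open import Relation.Binary.Bundles using (Setoid)
open import Relation.Binary.Construct.Closure.ReflexiveTransitive
  using (Star; _◅_; _◅◅_; gmap; reverse; ε)
open import Relation.Binary.Definitions using (tri<; tri>; tri≈)
open import Relation.Binary.PropositionalEquality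
  using (_≡_; _≢_; cong; refl; setoid; subst; subst₂; sym; trans)
open import Relation.Nullary using (Dec; contradiction; no; recompute; yes; ¬_)
open import Relation.Unary using (Pred; _∈_; _⊆_)

-- Separation replaces cycles because it composes: two cycles through an edge do not visibly yield a
-- third, whereas walks that avoid v join at whichever end of the middle edge differs from v. The
-- cost is the passage back from separation to a cycle.
--
-- The isomorphisms and the numberings of lobes that come with Γ are unrelated to T in two ways. The
-- numbering at a vertex need not give the slot `home` to the lobe through which the vertex was
-- reached, and the vertex need not sit at the representative at which T glues. A transposition of
-- two slots of one orbit repairs the first, an element of H the second. Both preserve orbits, and
-- orbits are all that μ records.
--
-- The side conditions in the names of copies and vertices of T are irrelevant, so equal data give
-- equal names; excluded middle recovers a condition where an argument needs it.

-- Cyclic successor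

toℕ-next : ∀ {n} (i : Fin (suc n)) → toℕ i < n →
           toℕ (suc (toℕ i) mod suc n) ≡ suc (toℕ i)
toℕ-next {n} i i<n =
  trans (toℕ-fromℕ< (m%n<n (suc (toℕ i)) (suc n))) (m<n⇒m%n≡m (s≤s i<n))

next-inject₁ : ∀ {n} (j : Fin n) → suc (toℕ (inject₁ j)) mod suc n ≡ suc j
next-inject₁ {n} j = toℕ-injective
  (trans (toℕ-next (inject₁ j) (subst (_< n) (sym (toℕ-inject₁ j)) (toℕ<n j)))
         (cong suc (toℕ-inject₁ j)))

next-fromℕ : ∀ n → suc (toℕ (fromℕ n)) mod suc n ≡ zero
next-fromℕ n rewrite toℕ-fromℕ n = toℕ-injective
  (trans (toℕ-fromℕ< (m%n<n (suc n) (suc n))) (n%n≡0 (suc n)))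

-- Separation of edges by vertices

infix 4 _∈ₑ_

_∈ₑ_ : ∀ {Γ} → V Γ → Edge Γ → Set
x ∈ₑ e = src e ≡ x ⊎ tgt e ≡ x

src≢tgt : ∀ {Γ} (e : Edge Γ) → src e ≢ tgt e
src≢tgt {Γ} e eq = Adj-irr Γ (subst (Adj Γ (src e)) (sym eq) (isAdj e))

Joins-Adj : ∀ {Γ} (e : Edge Γ) {x y} → Joins e x y → Adj Γ x y
Joins-Adj     e (inj₁ (refl , refl)) = isAdj e
Joins-Adj {Γ} e (inj₂ (refl , refl)) = Adj-sym Γ (isAdj e)

Joins-ends : ∀ {Γ} (e : Edge Γ) x y {z} → Joins e x y → z ∈ₑ e → z ≡ x ⊎ z ≡ y
Joins-ends e _ _ (inj₁ (refl , refl)) (inj₁ refl) = inj₁ refl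
Joins-ends e _ _ (inj₁ (refl , refl)) (inj₂ refl) = inj₂ refl
Joins-ends e _ _ (inj₂ (refl , refl)) (inj₁ refl) = inj₂ refl
Joins-ends e _ _ (inj₂ (refl , refl)) (inj₂ refl) = inj₁ refl

Avoid : (Γ : Graph) → V Γ → V Γ → V Γ → Set
Avoid Γ v = Star (λ x y → Adj Γ x y × x ≢ v × y ≢ v)

Avoid-sym : ∀ Γ {v x y} → Avoid Γ v x y → Avoid Γ v y x
Avoid-sym Γ = reverse (λ (a , p , q) → Adj-sym Γ a , q , p)

infix 4 _~_

-- No vertex separates e from f.
_~_ : ∀ {Γ} → Edge Γ → Edge Γ → Set
_~_ {Γ} e f = ∀ v {x y} → x ∈ₑ e → y ∈ₑ f → x ≢ v → y ≢ v → Avoid Γ v x y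

~-sym : ∀ {Γ} {e f : Edge Γ} → e ~ f → f ~ e
~-sym {Γ} e~f v x∈ y∈ x≢v y≢v = Avoid-sym Γ (e~f v y∈ x∈ y≢v x≢v)

~-joined : ∀ {Γ} (e f : Edge Γ) → Joins e (src f) (tgt f) → e ~ f
~-joined {Γ} e f j v x∈e y∈f x≢v y≢v
  with Joins-ends e _ _ j x∈e | y∈f
... | inj₁ refl | inj₁ refl = ε
... | inj₂ refl | inj₂ refl = ε
... | inj₁ refl | inj₂ refl = (isAdj f , x≢v , y≢v) ◅ ε
... | inj₂ refl | inj₁ refl = (Adj-sym Γ (isAdj f) , x≢v , y≢v) ◅ ε

module Classical (em : ExcludedMiddle 0ℓ) where

  other-end : ∀ {Γ} (e : Edge Γ) v → ∃[ x ] x ∈ₑ e × x ≢ v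
  other-end e v with em {src e ≡ v}
  ... | yes eq = tgt e , inj₂ refl , λ eq′ → src≢tgt e (trans eq (sym eq′))
  ... | no neq = src e , inj₁ refl , neq

  -- No single vertex covers both ends of f, so the two walks always have a place to meet.
  ~-trans : ∀ {Γ} {e f g : Edge Γ} → e ~ f → f ~ g → e ~ g
  ~-trans {f = f} e~f f~g v x∈ y∈ x≢v y≢v with other-end f v
  ... | z , z∈ , z≢v = e~f v x∈ z∈ x≢v z≢v ◅◅ f~g v z∈ y∈ z≢v y≢v

  module _ {Γ : Graph} (c : Cycle Γ) (v : V Γ) where
    open Cycle c

    private
      last : Fin (3 + n)
      last = fromℕ (2 + n)

      up : ∀ d i j → toℕ j ≡ d + toℕ i →
           (∀ l → toℕ i ≤ toℕ l → toℕ l ≤ toℕ j → vertex l ≢ v) →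
           Avoid Γ v (vertex i) (vertex j)
      up zero i j eq _ with refl ← toℕ-injective eq = ε
      up (suc d) i j eq free =
        (edge i , free i ≤-refl i≤j , free (next i) i≤i⁺ i⁺≤j) ◅
        up d (next i) j (trans eq (trans (sym (+-suc d (toℕ i))) (cong (d +_) (sym eq⁺))))
           (λ l p q → free l (≤-trans i≤i⁺ p) q)
        where
        i<j : toℕ i < toℕ j
        i<j = subst (toℕ i <_) (sym eq) (s≤s (m≤n+m (toℕ i) d))
        i≤j : toℕ i ≤ toℕ j
        i≤j = ≤-trans (n≤1+n _) i<j
        eq⁺ : toℕ (next i) ≡ suc (toℕ i)
        eq⁺ = toℕ-next i (<-≤-trans i<j (≤-pred (toℕ<n j)))
        i≤i⁺ : toℕ i ≤ toℕ (next i)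
        i≤i⁺ = subst (toℕ i ≤_) (sym eq⁺) (n≤1+n _)
        i⁺≤j : toℕ (next i) ≤ toℕ j
        i⁺≤j = subst (_≤ toℕ j) (sym eq⁺) i<j

      difference : ∀ {a b} → a ≤ b → ∃[ d ] b ≡ d + a
      difference {a} {b} p = b ∸ a , sym (m∸n+n≡m p)

      down-to-zero : ∀ i → (∀ l → toℕ l ≤ toℕ i → vertex l ≢ v) →
                     Avoid Γ v (vertex i) (vertex zero)
      down-to-zero i free with difference {0} {toℕ i} z≤n
      ... | d , eq = Avoid-sym Γ (up d zero i eq (λ l _ → free l))

      ≤last : ∀ (l : Fin (3 + n)) → toℕ l ≤ toℕ last
      ≤last l = subst (toℕ l ≤_) (sym (toℕ-fromℕ (2 + n))) (≤-pred (toℕ<n l))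

      up-to-last : ∀ i → (∀ l → toℕ i ≤ toℕ l → vertex l ≢ v) →
                   Avoid Γ v (vertex i) (vertex last)
      up-to-last i free with difference (≤last i)
      ... | d , eq = up d i last eq (λ l p _ → free l p)

      turn : vertex last ≢ v → vertex zero ≢ v →
             Avoid Γ v (vertex last) (vertex zero)
      turn p q = (subst (λ i → Adj Γ (vertex last) (vertex i)) (next-fromℕ (2 + n)) (edge last)
                 , p , q) ◅ ε

    -- A cycle meets v at most once, at index k say: below k descend to zero, above k climb to the
    -- last index and take the closing edge.
    to-zero : vertex zero ≢ v → ∀ i → vertex i ≢ v →
              Avoid Γ v (vertex i) (vertex zero)
    to-zero 0≢v i i≢v with em {∃[ k ] vertex k ≡ v}
    ... | no none = down-to-zero i (λ l _ eq → none (l , eq))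
    ... | yes (k , k≡v) with <-cmp (toℕ i) (toℕ k)
    ... | tri< i<k _ _ = down-to-zero i λ l l≤i l≡v →
          <-irrefl (cong toℕ (injective (trans l≡v (sym k≡v)))) (≤-<-trans l≤i i<k)
    ... | tri≈ _ eq _ with refl ← toℕ-injective eq = ⊥-elim (i≢v k≡v)
    ... | tri> _ _ k<i = up-to-last i above ◅◅ turn (above last (≤last i)) 0≢v
      where
      above : ∀ l → toℕ i ≤ toℕ l → vertex l ≢ v
      above l i≤l l≡v =
        <-irrefl (cong toℕ (injective (trans k≡v (sym l≡v)))) (<-≤-trans k<i i≤l)

    cycle-avoid : ∀ i j → vertex i ≢ v → vertex j ≢ v →
                  Avoid Γ v (vertex i) (vertex j)
    cycle-avoid i j i≢v j≢v with em {vertex zero ≡ v}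
    ... | no 0≢v = to-zero 0≢v i i≢v ◅◅ Avoid-sym Γ (to-zero 0≢v j j≢v)
    -- With v at index zero the closing edge is lost, but both vertices can climb to the last index.
    ... | yes 0≡v = up-to-last i (λ l i≤l → positive l (<-≤-trans (0< i i≢v) i≤l)) ◅◅
                    Avoid-sym Γ (up-to-last j (λ l j≤l → positive l (<-≤-trans (0< j j≢v) j≤l)))
      where
      0< : ∀ l → vertex l ≢ v → 0 < toℕ l
      0< zero    l≢v = ⊥-elim (l≢v 0≡v)
      0< (suc l) _   = s≤s z≤n
      positive : ∀ l → 0 < toℕ l → vertex l ≢ v
      positive l 0<l l≡v =
        <-irrefl (cong toℕ (injective (trans 0≡v (sym l≡v)))) 0<l

  ≅⇒~ : ∀ {Γ} {e f : Edge Γ} → e ≅ f → e ~ f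
  ≅⇒~ {e = e} {f} (inj₁ j) = ~-joined e f j
  ≅⇒~ {e = e} {f} (inj₂ (c , (i , ei) , (j , fj))) v x∈ y∈ x≢v y≢v
    with Joins-ends e _ _ ei x∈ | Joins-ends f _ _ fj y∈
  ... | inj₁ refl | inj₁ refl = cycle-avoid c v _ _ x≢v y≢v
  ... | inj₁ refl | inj₂ refl = cycle-avoid c v _ _ x≢v y≢v
  ... | inj₂ refl | inj₁ refl = cycle-avoid c v _ _ x≢v y≢v
  ... | inj₂ refl | inj₂ refl = cycle-avoid c v _ _ x≢v y≢v

≃-sym : ∀ {Γ Δ} → Γ ≃ Δ → Δ ≃ Γ
≃-sym {Γ} {Δ} f = record
  { bij = ↔-sym (_≃_.bij f)
  ; adj = λ {x} {y} → mk⇔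
      (λ a → Equivalence.from (_≃_.adj f)
        (subst₂ (Adj Δ) (sym (_≃_.strictlyInverseˡ f x)) (sym (_≃_.strictlyInverseˡ f y)) a))
      (λ a → subst₂ (Adj Δ) (_≃_.strictlyInverseˡ f x) (_≃_.strictlyInverseˡ f y)
        (Equivalence.to (_≃_.adj f) a))
  }

≃-trans : ∀ {Γ Δ Θ} → Γ ≃ Δ → Δ ≃ Θ → Γ ≃ Θ
≃-trans f g = record
  { bij = _≃_.bij g ↔-∘ _≃_.bij f
  ; adj = _≃_.adj g ⇔-∘ _≃_.adj f
  }

-- Walks and simple paths

module Walks (Γ : Graph) where

  Walk : V Γ → V Γ → Set
  Walk = Star (Adj Γ)

  private variable
    x y z u v : V Γ

  -- ° leaves out the final vertex of the walk, so that it is additive.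
  infix 4 _∈°_ _∈•_

  _∈°_ : V Γ → Walk x y → Set
  v ∈° ε = ⊥
  v ∈° (_◅_ {x} e p) = v ≡ x ⊎ v ∈° p

  _∈•_ : V Γ → Walk x y → Set
  _∈•_ {y = y} v p = v ∈° p ⊎ v ≡ y

  Simple : Walk x y → Set
  Simple ε = ⊤
  Simple (_◅_ {x} e p) = ¬ x ∈• p × Simple p

  Uses : V Γ → V Γ → Walk x y → Set
  Uses u v ε = ⊥
  Uses u v (_◅_ {x} {z} e p) = ((u ≡ x × v ≡ z) ⊎ (u ≡ z × v ≡ x)) ⊎ Uses u v p

  start∈• : (p : Walk x y) → x ∈• p
  start∈• ε = inj₂ refl
  start∈• (e ◅ p) = inj₁ (inj₁ refl)

  ∈•-there : {e : Adj Γ x z} {p : Walk z y} → v ∈• p → v ∈• (e ◅ p)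
  ∈•-there = Sum.map₁ inj₂

  ∈°-++⁻ : (p : Walk x y) {q : Walk y z} → v ∈° (p ◅◅ q) → v ∈° p ⊎ v ∈° q
  ∈°-++⁻ ε v∈ = inj₂ v∈
  ∈°-++⁻ (e ◅ p) (inj₁ eq) = inj₁ (inj₁ eq)
  ∈°-++⁻ (e ◅ p) (inj₂ v∈) = Sum.map₁ inj₂ (∈°-++⁻ p v∈)

  ∈•-++⁻ : (p : Walk x y) {q : Walk y z} → v ∈• (p ◅◅ q) → v ∈° p ⊎ v ∈• q
  ∈•-++⁻ p (inj₁ v∈) = Sum.map₂ inj₁ (∈°-++⁻ p v∈)
  ∈•-++⁻ p (inj₂ eq) = inj₂ (inj₂ eq)

  ∈•-++⁺ʳ : (p : Walk x y) {q : Walk y z} → v ∈• q → v ∈• (p ◅◅ q)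
  ∈•-++⁺ʳ ε v∈ = v∈
  ∈•-++⁺ʳ (e ◅ p) {q} v∈ = ∈•-there {e = e} {p = p ◅◅ q} (∈•-++⁺ʳ p v∈)

  ∈°-++⁺ˡ : (p : Walk x y) {q : Walk y z} → v ∈° p → v ∈° (p ◅◅ q)
  ∈°-++⁺ˡ (e ◅ p) (inj₁ eq) = inj₁ eq
  ∈°-++⁺ˡ (e ◅ p) (inj₂ v∈) = inj₂ (∈°-++⁺ˡ p v∈)

  ∈•-++⁺ˡ : (p : Walk x y) {q : Walk y z} → v ∈• p → v ∈• (p ◅◅ q)
  ∈•-++⁺ˡ p (inj₁ v∈) = inj₁ (∈°-++⁺ˡ p v∈)
  ∈•-++⁺ˡ p {q} (inj₂ refl) = ∈•-++⁺ʳ p (start∈• q)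

  Simple-++⁺ : (p : Walk x y) {q : Walk y z} → Simple p → Simple q →
               (∀ {v} → v ∈° p → ¬ v ∈• q) → Simple (p ◅◅ q)
  Simple-++⁺ ε _ sq _ = sq
  Simple-++⁺ (e ◅ p) {q} (x∉p , sp) sq disj =
    (λ x∈ → [ x∉p ∘ inj₁ , disj (inj₁ refl) ]′ (∈•-++⁻ p {q} x∈)) ,
    Simple-++⁺ p sp sq (disj ∘ inj₂)

  Simple-++⁻ : (p : Walk x y) {q : Walk y z} → Simple (p ◅◅ q) →
               Simple p × Simple q × (∀ {v} → v ∈° p → ¬ v ∈• q)
  Simple-++⁻ ε s = tt , s , λ ()
  Simple-++⁻ (e ◅ p) {q} (x∉ , s) with Simple-++⁻ p s
  ... | sp , sq , disj = (x∉ ∘ ∈•-++⁺ˡ p , sp) , sq , λ where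
    (inj₁ refl) → x∉ ∘ ∈•-++⁺ʳ p
    (inj₂ v∈)   → disj v∈

  Simple-end : (p : Walk x y) → Simple p → ¬ y ∈° p
  Simple-end (e ◅ p) (x∉ , s) (inj₁ refl) = x∉ (inj₂ refl)
  Simple-end (e ◅ p) (x∉ , s) (inj₂ y∈) = Simple-end p s y∈

  split : (p : Walk x y) → v ∈• p →
          Σ[ q ∈ Walk x v ] Σ[ r ∈ Walk v y ] p ≡ q ◅◅ r
  split p (inj₂ refl) = p , ε , sym (++-ε p)
    where
    ++-ε : ∀ {x y} (p : Walk x y) → p ◅◅ ε ≡ p
    ++-ε ε = refl
    ++-ε (e ◅ p) = cong (e ◅_) (++-ε p)
  split (e ◅ p) (inj₁ (inj₁ refl)) = ε , e ◅ p , refl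
  split (e ◅ p) (inj₁ (inj₂ v∈)) with split p (inj₁ v∈)
  ... | q , r , refl = e ◅ q , r , refl

  rev : Walk x y → Walk y x
  rev ε = ε
  rev (e ◅ p) = rev p ◅◅ (Adj-sym Γ e ◅ ε)

  ∈•-rev : (p : Walk x y) → v ∈• rev p → v ∈• p
  ∈•-rev ε v∈ = v∈
  ∈•-rev (e ◅ p) v∈ with ∈•-++⁻ (rev p) v∈
  ... | inj₁ v∈p = ∈•-there {e = e} {p = p} (∈•-rev p (inj₁ v∈p))
  ... | inj₂ (inj₁ (inj₁ refl)) = ∈•-there {e = e} {p = p} (start∈• p)
  ... | inj₂ (inj₂ refl) = inj₁ (inj₁ refl)

  Simple-rev : (p : Walk x y) → Simple p → Simple (rev p)
  Simple-rev ε s = tt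
  Simple-rev (e ◅ p) (x∉ , s) =
    Simple-++⁺ (rev p) (Simple-rev p s)
      ((λ { (inj₂ refl) → Adj-irr Γ e }) , tt)
      λ where
        v∈ (inj₁ (inj₁ refl)) → Simple-end (rev p) (Simple-rev p s) v∈
        v∈ (inj₂ refl) → x∉ (∈•-rev p (inj₁ v∈))

  Uses-++⁺ʳ : (p : Walk x y) {q : Walk y z} → Uses u v q → Uses u v (p ◅◅ q)
  Uses-++⁺ʳ ε w = w
  Uses-++⁺ʳ (e ◅ p) w = inj₂ (Uses-++⁺ʳ p w)

  Uses⇒∈• : (p : Walk x y) → Uses u v p → v ∈• p
  Uses⇒∈• (e ◅ p) (inj₁ (inj₁ (_ , refl))) = ∈•-there {e = e} {p = p} (start∈• p)
  Uses⇒∈• (e ◅ p) (inj₁ (inj₂ (_ , refl))) = inj₁ (inj₁ refl)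
  Uses⇒∈• (e ◅ p) (inj₂ w) = ∈•-there {e = e} {p = p} (Uses⇒∈• p w)

  Walk⇒Avoid : (p : Walk x y) → ¬ v ∈• p → Avoid Γ v x y
  Walk⇒Avoid ε v∉ = ε
  Walk⇒Avoid (e ◅ p) v∉ =
    (e , (λ { refl → v∉ (inj₁ (inj₁ refl)) })
       , (λ { refl → v∉ (∈•-there {e = e} {p = p} (start∈• p)) })) ◅
    Walk⇒Avoid p (v∉ ∘ ∈•-there {e = e} {p = p})

  len : Walk x y → ℕ
  len ε = 0
  len (e ◅ p) = suc (len p)

  at : (p : Walk x y) → Fin (suc (len p)) → V Γ
  at {x} ε _ = x
  at {x} (e ◅ p) zero = x
  at (e ◅ p) (suc i) = at p i

  at-zero : (p : Walk x y) → at p zero ≡ x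
  at-zero ε = refl
  at-zero (e ◅ p) = refl

  at-last : (p : Walk x y) → at p (fromℕ (len p)) ≡ y
  at-last ε = refl
  at-last (e ◅ p) = at-last p

  at∈• : (p : Walk x y) (i : Fin (suc (len p))) → at p i ∈• p
  at∈• ε _ = inj₂ refl
  at∈• (e ◅ p) zero = inj₁ (inj₁ refl)
  at∈• (e ◅ p) (suc i) = ∈•-there {e = e} {p = p} (at∈• p i)

  at-injective : (p : Walk x y) → Simple p → Injective _≡_ _≡_ (at p)
  at-injective ε _ {zero} {zero} _ = refl
  at-injective (e ◅ p) s {zero} {zero} _ = refl
  at-injective (e ◅ p) (x∉ , s) {zero} {suc j} eq =
    ⊥-elim (x∉ (subst (_∈• p) (sym eq) (at∈• p j)))
  at-injective (e ◅ p) (x∉ , s) {suc i} {zero} eq =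
    ⊥-elim (x∉ (subst (_∈• p) eq (at∈• p i)))
  at-injective (e ◅ p) (x∉ , s) {suc i} {suc j} eq = cong suc (at-injective p s eq)

  at-Adj : (p : Walk x y) (i : Fin (len p)) → Adj Γ (at p (inject₁ i)) (at p (suc i))
  at-Adj {x} (e ◅ p) zero = subst (Adj Γ x) (sym (at-zero p)) e
  at-Adj (e ◅ p) (suc i) = at-Adj p i

  Uses-at : (p : Walk x y) → Uses u v p → ∃[ i ]
            ((u ≡ at p (inject₁ i) × v ≡ at p (suc i)) ⊎
             (u ≡ at p (suc i) × v ≡ at p (inject₁ i)))
  Uses-at (e ◅ p) (inj₁ (inj₁ (refl , refl))) = zero , inj₁ (refl , sym (at-zero p))
  Uses-at (e ◅ p) (inj₁ (inj₂ (refl , refl))) = zero , inj₂ (sym (at-zero p) , refl)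
  Uses-at (e ◅ p) (inj₂ w) with Uses-at p w
  ... | i , r = suc i , r

  module _ (e f : Edge Γ) where

    -- The edge e closes a simple path between its ends to a cycle. A path of one step is too short
    -- for that, but then f has the same ends as e.
    close-up : (p : Walk (src e) (tgt e)) → Simple p →
               Uses (src f) (tgt f) p → e ≅ f
    close-up (_ ◅ ε) _ (inj₁ (inj₁ (p , q))) = inj₁ (inj₁ (sym p , sym q))
    close-up (_ ◅ ε) _ (inj₁ (inj₂ (p , q))) = inj₁ (inj₂ (sym q , sym p))
    close-up p@(_ ◅ _ ◅ r) s w = inj₂ (c , e-on , f-on)
      where
      c : Cycle Γ
      c = record
        -- Two steps precede r, so the path has `3 + len r` vertices.
        { n = len r ; vertex = at p ; injective = at-injective p s
        ; edge = edge }
        where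
        edge : ∀ i → Adj Γ (at p i) (at p (suc (toℕ i) mod suc (len p)))
        edge i with view i
        ... | ‵fromℕ rewrite next-fromℕ (len p) =
          subst (λ z → Adj Γ z (src e)) (sym (at-last p)) (Adj-sym Γ (isAdj e))
        ... | ‵inject₁ j rewrite next-inject₁ j = at-Adj p j
      open Cycle c
      e-on : e onCycle c
      e-on = fromℕ (len p) ,
        inj₂ (cong (at p) (sym (next-fromℕ (len p))) , sym (at-last p))
      f-on : f onCycle c
      f-on with Uses-at p w
      ... | i , inj₁ (a , b) = inject₁ i ,
        inj₁ (a , trans b (cong (at p) (sym (next-inject₁ i))))
      ... | i , inj₂ (a , b) = inject₁ i ,
        inj₂ (trans a (cong (at p) (sym (next-inject₁ i))) , b)

-- From unseparated edges to a common cycle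

module Whitney (em : ExcludedMiddle 0ℓ) (Γ : Graph) where
  open Walks Γ

  private variable
    x y z a b c : V Γ

  suffix-Simple : (p : Walk x y) {q : Walk y z} → Simple (p ◅◅ q) → Simple q
  suffix-Simple p s = proj₁ (proj₂ (Simple-++⁻ p s))

  simplify : Walk x y → Σ[ p ∈ Walk x y ] Simple p
  simplify ε = ε , tt
  simplify (_◅_ {x} e w) with simplify w
  ... | p , s with em {x ∈• p}
  ... | no x∉ = e ◅ p , x∉ , s
  ... | yes x∈ with split p x∈
  ... | q , r , refl = r , suffix-Simple q s

  -- The walk is stopped at its first vertex in S and its loops are erased on the way, which leaves
  -- a detour that can be spliced into a path without repetition.
  first-hit : (S : Pred (V Γ) 0ℓ) (v : V Γ) → z ≢ v → Avoid Γ v z c → S c →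
              Σ[ q ∈ V Γ ] q ≢ v × S q × Σ[ p ∈ Walk z q ] Simple p ×
              (∀ {u} → u ∈° p → ¬ S u × u ≢ v)
  first-hit {z} S v z≢v w Sc with em {S z}
  ... | yes Sz = z , z≢v , Sz , ε , tt , λ ()
  first-hit {z} S v z≢v ε Sc | no ¬Sz = ⊥-elim (¬Sz Sc)
  first-hit {z} S v z≢v ((e , _ , y≢v) ◅ w) Sc | no ¬Sz
    with first-hit S v y≢v w Sc
  ... | q , q≢v , Sq , p , s , out with em {z ∈• p}
  ... | no z∉ = q , q≢v , Sq , e ◅ p , (z∉ , s) , λ where
    (inj₁ refl) → ¬Sz , z≢v
    (inj₂ u∈) → out u∈
  ... | yes z∈ with split p z∈
  ... | p₁ , p₂ , refl = q , q≢v , Sq , p₂ , suffix-Simple p₁ s , λ u∈ →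
    out (∈°-++⁺ʳ p₁ u∈)
    where
    ∈°-++⁺ʳ : ∀ {x y z v} (p : Walk x y) {q : Walk y z} → v ∈° q → v ∈° (p ◅◅ q)
    ∈°-++⁺ʳ ε v∈ = v∈
    ∈°-++⁺ʳ (e ◅ p) v∈ = inj₂ (∈°-++⁺ʳ p v∈)

  -- A simple path through y is rerouted along the edge yz: follow a walk
  -- from z that avoids y until it meets the path again, at q say, and replace
  -- the stretch of the path between y and q.
  reroute : (p : Walk a b) → Simple p → y ∈• p → Adj Γ y z →
            Avoid Γ y z c → c ∈• p →
            Σ[ p′ ∈ Walk a b ] Simple p′ × Uses y z p′
  reroute {y = y} {z} p s y∈ yz w c∈
    with first-hit (_∈• p) y (λ { refl → Adj-irr Γ yz }) w c∈ | split p y∈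
  ... | q , q≢y , q∈ , r , sr , out | p₁ , p₂ , refl
    with Simple-++⁻ p₁ s | ∈•-++⁻ p₁ q∈
  ... | sp₁ , sp₂ , disj | inj₂ q∈p₂ with split p₂ q∈p₂
  ... | ε , _ , refl = ⊥-elim (q≢y refl)
  ... | m₁@(_ ◅ _) , m₂ , refl with Simple-++⁻ m₁ sp₂
  ... | _ , sm₂ , disj₂ =
    -- Here q comes after y: leave the path at y along yz, and r returns to it at q.
    p₁ ◅◅ (yz ◅ (r ◅◅ m₂)) ,
    Simple-++⁺ p₁ sp₁ (y∉ , Simple-++⁺ r sr sm₂ out-m₂) disj′ ,
    Uses-++⁺ʳ p₁ (inj₁ (inj₁ (refl , refl)))
    where
    out-m₂ : ∀ {u} → u ∈° r → ¬ u ∈• m₂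
    out-m₂ u∈ u∈m = proj₁ (out u∈) (∈•-++⁺ʳ p₁ (∈•-++⁺ʳ m₁ u∈m))
    y∉ : ¬ y ∈• (r ◅◅ m₂)
    y∉ y∈ with ∈•-++⁻ r {m₂} y∈
    ... | inj₁ y∈r = proj₂ (out y∈r) refl
    ... | inj₂ y∈m = disj₂ (inj₁ refl) y∈m
    disj′ : ∀ {u} → u ∈° p₁ → ¬ u ∈• (yz ◅ (r ◅◅ m₂))
    disj′ u∈ u∈′ with ∈•-++⁻ (yz ◅ r) {m₂} u∈′
    ... | inj₁ (inj₁ refl) = disj u∈ (start∈• (m₁ ◅◅ m₂))
    ... | inj₁ (inj₂ u∈r) = proj₁ (out u∈r) (∈•-++⁺ˡ p₁ (inj₁ u∈))
    ... | inj₂ u∈m = disj u∈ (∈•-++⁺ʳ m₁ u∈m)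
  reroute {y = y} {z} p s y∈ yz w c∈
    | q , q≢y , q∈ , r , sr , out | p₁ , p₂ , refl
    | sp₁ , sp₂ , disj | inj₁ q∈p₁ with split p₁ (inj₁ q∈p₁)
  ... | m₁ , m₂ , refl with Simple-++⁻ m₁ sp₁
  ... | sm₁ , _ , disj₁ =
    -- Here q comes before y: leave the path at q, run r backwards to z, and rejoin at y along zy.
    m₁ ◅◅ (rev r ◅◅ (zy ◅ p₂)) ,
    Simple-++⁺ m₁ sm₁ (Simple-++⁺ (rev r) (Simple-rev r sr) (z∉p₂ , sp₂) disj₂) disj₃ ,
    Uses-++⁺ʳ m₁ (Uses-++⁺ʳ (rev r) (inj₁ (inj₂ (refl , refl))))
    where
    zy : Adj Γ z y
    zy = Adj-sym Γ yz
    r∉p₂ : ∀ {u} → u ∈• r → ¬ u ∈• p₂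
    r∉p₂ (inj₁ u∈) u∈p = proj₁ (out u∈) (∈•-++⁺ʳ (m₁ ◅◅ m₂) u∈p)
    r∉p₂ (inj₂ refl) = disj q∈p₁
    z∉p₂ : ¬ z ∈• p₂
    z∉p₂ = r∉p₂ (start∈• r)
    disj₂ : ∀ {u} → u ∈° rev r → ¬ u ∈• (zy ◅ p₂)
    disj₂ u∈ (inj₁ (inj₁ refl)) = Simple-end (rev r) (Simple-rev r sr) u∈
    disj₂ u∈ (inj₁ (inj₂ u∈p)) = r∉p₂ (∈•-rev r (inj₁ u∈)) (inj₁ u∈p)
    disj₂ u∈ (inj₂ eq) = r∉p₂ (∈•-rev r (inj₁ u∈)) (inj₂ eq)
    m₁∉r : ∀ {u} → u ∈° m₁ → ¬ u ∈• r
    m₁∉r u∈ (inj₁ u∈r) = proj₁ (out u∈r) (∈•-++⁺ˡ (m₁ ◅◅ m₂) (∈•-++⁺ˡ m₁ (inj₁ u∈)))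
    m₁∉r u∈ (inj₂ refl) = disj₁ u∈ (start∈• m₂)
    disj₃ : ∀ {u} → u ∈° m₁ → ¬ u ∈• (rev r ◅◅ (zy ◅ p₂))
    disj₃ u∈ u∈′ with ∈•-++⁻ (rev r) {zy ◅ p₂} u∈′
    ... | inj₁ u∈r = m₁∉r u∈ (∈•-rev r (inj₁ u∈r))
    ... | inj₂ (inj₁ (inj₁ refl)) = m₁∉r u∈ (start∈• r)
    ... | inj₂ (inj₁ (inj₂ u∈p)) = disj (∈°-++⁺ˡ m₁ u∈) (inj₁ u∈p)
    ... | inj₂ (inj₂ eq) = disj (∈°-++⁺ˡ m₁ u∈) (inj₂ eq)

  module _ (e f : Edge Γ) (e~f : e ~ f) where

    -- Every path between the ends of e contains t, so this supplies the return walk that `reroute`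
    -- asks for.
    back-to-e : ∀ {c} → c ∈ₑ f → c ≢ y → ∃[ t ] t ∈ₑ e × Avoid Γ y c t
    back-to-e {y} c∈ c≢y with Classical.other-end em e y
    ... | t , t∈ , t≢y = t , t∈ , Avoid-sym Γ (e~f y t∈ c∈ t≢y c≢y)

    ends∈• : (p : Walk (src e) (tgt e)) {t : V Γ} → t ∈ₑ e → t ∈• p
    ends∈• p (inj₁ refl) = start∈• p
    ends∈• p (inj₂ refl) = inj₂ refl

    -- The path is made to pass through each vertex of w in turn. As w is simple, its remainder
    -- avoids x; it leads to f, and from there `back-to-e` leads to the path again.
    follow : (p : Walk (src e) (tgt e)) → Simple p → x ∈• p →
             (w : Walk x (src f)) → Simple w →
             Σ[ p′ ∈ Walk (src e) (tgt e) ] Simple p′ × src f ∈• p′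
    follow p s x∈ ε _ = p , s , x∈
    follow p s x∈ (xy ◅ w) (x∉ , sw)
      with back-to-e (inj₁ refl) (λ { refl → x∉ (inj₂ refl) })
    ... | t , t∈ , c⇝t with reroute p s x∈ xy (Walk⇒Avoid w x∉ ◅◅ c⇝t) (ends∈• p t∈)
    ... | p′ , s′ , use = follow p′ s′ (Uses⇒∈• p′ use) w sw

    ~⇒≅-from : Walk (src e) (src f) → e ≅ f
    ~⇒≅-from w₀ with simplify w₀
    ... | w , sw with follow (isAdj e ◅ ε) ((λ { (inj₂ eq) → src≢tgt e eq }) , tt)
                             (inj₁ (inj₁ refl)) w sw
    -- The path now passes through `src f`; one more rerouting, along f itself, makes it use f.
    ... | p , s , c∈ with back-to-e (inj₂ refl) (src≢tgt f ∘ sym)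
    ... | t , t∈ , d⇝t with reroute p s c∈ (isAdj f) d⇝t (ends∈• p t∈)
    ... | p′ , s′ , use = close-up e f p′ s′ use

  ~⇒≅ : Connected Γ → {e f : Edge Γ} → e ~ f → e ≅ f
  ~⇒≅ conn {e} {f} e~f = ~⇒≅-from e f e~f (conn (src e) (src f))

-- Cardinalities and encodings

injective∧surjective⇒Inverse :
  {A : Set} {S : Setoid 0ℓ 0ℓ} (f : A → Setoid.Carrier S) →
  (∀ {a b} → Setoid._≈_ S (f a) (f b) → a ≡ b) →
  (∀ y → ∃[ a ] Setoid._≈_ S (f a) y) →
  Inverse (setoid A) S
injective∧surjective⇒Inverse {S = S} f inj surj = record
  { to        = f
  ; from      = proj₁ ∘ surj
  ; to-cong   = λ { refl → S.refl }
  ; from-cong = λ {x} {y} x≈y →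
      inj (S.trans (proj₂ (surj x)) (S.trans x≈y (S.sym (proj₂ (surj y)))))
  ; inverse   = (λ { {y} refl → proj₂ (surj y) })
              , λ {_} {y} y≈ → inj (S.trans (proj₂ (surj y)) y≈)
  }
  where module S = Setoid S

module Counting (em : ExcludedMiddle 0ℓ) {A : Set} (code : A → ℕ)
                (code-injective : Injective _≡_ _≡_ code) where

  private
    Code : ℕ → Set
    Code n = ∃[ a ] code a ≡ n

    -- The number of codes below n. Ranking each element by the codes below its own removes the gaps
    -- from the encoding.
    count : ℕ → ℕ
    count zero = zero
    count (suc n) with em {Code n}
    ... | yes _ = suc (count n)
    ... | no  _ = count n

    count-step : ∀ n → count n ≤ count (suc n)
    count-step n with em {Code n}
    ... | yes _ = n≤1+n _
    ... | no  _ = ≤-refl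

    count-mono : ∀ {m} n → m ≤ n → count m ≤ count n
    count-mono zero z≤n = ≤-refl
    count-mono (suc n) m≤n with m≤n⇒m<n∨m≡n m≤n
    ... | inj₁ m<n = ≤-trans (count-mono n (≤-pred m<n)) (count-step n)
    ... | inj₂ refl = ≤-refl

    rank : A → ℕ
    rank = count ∘ code

    count-suc : ∀ a → count (suc (code a)) ≡ suc (rank a)
    count-suc a with em {Code (code a)}
    ... | yes _ = refl
    ... | no none = ⊥-elim (none (a , refl))

    rank-< : ∀ {a n} → code a < n → rank a < count n
    rank-< {a} {n} lt = subst (_≤ count n) (count-suc a) (count-mono n lt)

    rank-injective : Injective _≡_ _≡_ rank
    rank-injective {a} {b} eq with <-cmp (code a) (code b)
    ... | tri< lt _ _ = contradiction (rank-< lt) (<-irrefl eq)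
    ... | tri≈ _ eq′ _ = code-injective eq′
    ... | tri> _ _ gt = contradiction (rank-< gt) (<-irrefl (sym eq))

    ranked : ∀ n {m} → m < count n → ∃[ a ] rank a ≡ m
    ranked (suc n) {m} m< with em {Code n}
    ... | no _ = ranked n m<
    ... | yes (a , eq) with m≤n⇒m<n∨m≡n (≤-pred m<)
    ... | inj₁ m<n = ranked n m<n
    ... | inj₂ eq′ = a , trans (cong count eq) (sym eq′)

    Bounded : Set
    Bounded = ∃[ n ] (∀ a → code a < n)

    unbounded : ¬ Bounded → ∀ n → ∃[ a ] n ≤ code a
    unbounded ¬b n with em {∃[ a ] n ≤ code a}
    ... | yes w = w
    ... | no none = contradiction
      (n , λ a → ≰⇒> (λ n≤ → none (a , n≤))) ¬b

    count-unbounded : ¬ Bounded → ∀ m → ∃[ n ] m < count n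
    count-unbounded ¬b zero with unbounded ¬b 0
    ... | a , _ = suc (code a) , subst (0 <_) (sym (count-suc a)) (s≤s z≤n)
    count-unbounded ¬b (suc m) with count-unbounded ¬b m
    ... | n , m< with unbounded ¬b n
    ... | a , n≤ = suc (code a) ,
      subst (suc m <_) (sym (count-suc a)) (s≤s (<-≤-trans m< (count-mono (code a) n≤)))

  -- The ranks fill an initial segment of the naturals, or all of them when the codes are unbounded.
  cardinality : ∃[ κ ] HasCardinality (setoid A) κ
  cardinality with em {Bounded}
  ... | yes (n , bound) = fin (count n) , injective∧surjective⇒Inverse enum inj surj
    where
    enum : Fin (count n) → A
    enum i = proj₁ (ranked n (toℕ<n i))
    rank-enum : ∀ i → rank (enum i) ≡ toℕ i
    rank-enum i = proj₂ (ranked n (toℕ<n i))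
    inj : ∀ {i j} → enum i ≡ enum j → i ≡ j
    inj {i} {j} eq = toℕ-injective
      (trans (sym (rank-enum i)) (trans (cong rank eq) (rank-enum j)))
    surj : ∀ a → ∃[ i ] enum i ≡ a
    surj a = fromℕ< lt , rank-injective (trans (rank-enum _) (toℕ-fromℕ< lt))
      where lt = rank-< (bound a)
  ... | no ¬b = ℵ₀ , injective∧surjective⇒Inverse enum inj surj
    where
    big : ∀ m → ∃[ n ] m < count n
    big = count-unbounded ¬b
    enum : ℕ → A
    enum m = proj₁ (ranked (proj₁ (big m)) (proj₂ (big m)))
    rank-enum : ∀ m → rank (enum m) ≡ m
    rank-enum m = proj₂ (ranked (proj₁ (big m)) (proj₂ (big m)))
    inj : ∀ {i j} → enum i ≡ enum j → i ≡ j
    inj {i} {j} eq = trans (sym (rank-enum i)) (trans (cong rank eq) (rank-enum j))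
    surj : ∀ a → ∃[ i ] enum i ≡ a
    surj a = rank a , rank-injective (rank-enum _)

-- This is 2^m (2n + 1); injectivity is the uniqueness of the power of two and of the odd part.
pair : ℕ → ℕ → ℕ
pair zero    n = suc (n + n)
pair (suc m) n = pair m n + pair m n

private
  double-injective : ∀ m n → m + m ≡ n + n → m ≡ n
  double-injective zero zero eq = refl
  double-injective (suc m) (suc n) eq = cong suc (double-injective m n
    (suc-injective (trans (sym (+-suc m m)) (trans (suc-injective eq) (+-suc n n)))))

  odd≢even : ∀ m n → suc (m + m) ≢ n + n
  odd≢even m (suc n) eq = odd≢even n m (sym (trans (suc-injective eq) (+-suc n n)))

pair-injective : ∀ m n {m′ n′} → pair m n ≡ pair m′ n′ → m ≡ m′ × n ≡ n′
pair-injective zero n {zero} {n′} eq = refl , double-injective n n′ (suc-injective eq)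
pair-injective zero n {suc m′} {n′} eq = ⊥-elim (odd≢even n (pair m′ n′) eq)
pair-injective (suc m) n {zero} {n′} eq = ⊥-elim (odd≢even n′ (pair m n) (sym eq))
pair-injective (suc m) n {suc m′} {n′} eq
  with pair-injective m n {m′} {n′} (double-injective (pair m n) (pair m′ n′) eq)
... | refl , refl = refl , refl

⟦⟧→ℕ : ∀ κ → ⟦ κ ⟧ → ℕ
⟦⟧→ℕ (fin n) = toℕ
⟦⟧→ℕ ℵ₀      = id

⟦⟧→ℕ-injective : ∀ κ → Injective _≡_ _≡_ (⟦⟧→ℕ κ)
⟦⟧→ℕ-injective (fin n) = toℕ-injective
⟦⟧→ℕ-injective ℵ₀      = id

inhabitant : ∀ κ → κ ≢ fin 0 → ⟦ κ ⟧
inhabitant (fin zero)    κ≢0 = ⊥-elim (κ≢0 refl)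
inhabitant (fin (suc n)) _   = zero
inhabitant ℵ₀            _   = zero

inhabited : ∀ {κ} → ⟦ κ ⟧ → κ ≢ fin 0
inhabited () refl

-- Lobes of a connected graph

module Lobes (em : ExcludedMiddle 0ℓ) (Γ : Graph) (conn : Connected Γ) where
  open Setoid (ℒ Γ) using (_≈_)

  private variable
    e f M N : Edge Γ
    x y v p q : V Γ

  -- _≅_ wrapped in a record: unlike its unfolding, which does not mention the
  -- adjacency proofs of the edges, the record type determines both edges.
  infix 4 _≅ᴸ_

  record _≅ᴸ_ (M N : Lobe Γ) : Set where
    constructor ⟨_⟩
    field unwrap : M ≅ N

  open _≅ᴸ_ public

  ≅ᴸ-refl : M ≅ᴸ M
  ≅ᴸ-refl = ⟨ inj₁ (inj₁ (refl , refl)) ⟩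

  ≅ᴸ⇒~ : M ≅ᴸ N → M ~ N
  ≅ᴸ⇒~ {M} {N} ⟨ M≅N ⟩ = Classical.≅⇒~ em {e = M} {N} M≅N

  ~⇒≅ᴸ : M ~ N → M ≅ᴸ N
  ~⇒≅ᴸ {M} {N} M~N = ⟨ Whitney.~⇒≅ em Γ conn {M} {N} M~N ⟩

  ≅ᴸ-sym : M ≅ᴸ N → N ≅ᴸ M
  ≅ᴸ-sym {M} {N} M≅N = ~⇒≅ᴸ (~-sym {e = M} {N} (≅ᴸ⇒~ M≅N))

  ≅ᴸ-trans : e ≅ᴸ M → M ≅ᴸ N → e ≅ᴸ N
  ≅ᴸ-trans {e} {M} {N} e≅M M≅N =
    ~⇒≅ᴸ (Classical.~-trans em {e = e} {M} {N} (≅ᴸ⇒~ e≅M) (≅ᴸ⇒~ M≅N))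

  ≈⇒≅ᴸ : M ≈ N → M ≅ᴸ N
  ≈⇒≅ᴸ {N = N} (_ , ⊇) = ⟨ ⊇ {N} (unwrap (≅ᴸ-refl {N})) ⟩

  ≅ᴸ⇒≈ : M ≅ᴸ N → M ≈ N
  ≅ᴸ⇒≈ M≅N = (λ {e} M≅e → unwrap (≅ᴸ-trans {M = _} {N = e} (≅ᴸ-sym M≅N) ⟨ M≅e ⟩))
           , (λ {e} N≅e → unwrap (≅ᴸ-trans {M = _} {N = e} M≅N ⟨ N≅e ⟩))

  infix 4 _∈ᴸ_

  record _∈ᴸ_ (x : V Γ) (M : Lobe Γ) : Set where
    constructor mk
    field
      edge  : Edge Γ
      class : M ≅ᴸ edge
      end   : x ∈ₑ edge

  ∈ᴸ-resp : M ≅ᴸ N → x ∈ᴸ M → x ∈ᴸ N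
  ∈ᴸ-resp M≅N (mk e M≅e x∈) = mk e (≅ᴸ-trans (≅ᴸ-sym M≅N) M≅e) x∈

  ∈ₑ⇒∈ᴸ : x ∈ₑ e → x ∈ᴸ e
  ∈ₑ⇒∈ᴸ {e = e} x∈ = mk e ≅ᴸ-refl x∈

  lobe-avoid : x ∈ᴸ M → y ∈ᴸ M → x ≢ v → y ≢ v → Avoid Γ v x y
  lobe-avoid {M = M} (mk e M≅e x∈) (mk f M≅f y∈) x≢v y≢v =
    ≅ᴸ⇒~ (≅ᴸ-trans (≅ᴸ-sym M≅e) M≅f) _ x∈ y∈ x≢v y≢v

  -- After deletion of a vertex other than x the two lobes still meet at x; after deletion of x
  -- itself the walk from p to q joins them.
  lobes-unseparated : x ∈ᴸ M → p ∈ᴸ M → p ≢ x → x ∈ᴸ N → q ∈ᴸ N → q ≢ x →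
                      Avoid Γ x p q → M ≅ᴸ N
  lobes-unseparated {x} {M} {p} {N} {q} x∈M p∈M p≢x x∈N q∈N q≢x p⇝q = ~⇒≅ᴸ M~N
    where
    M~N : M ~ N
    M~N v {y} {z} y∈ z∈ y≢v z≢v = from-dec em
      where
      y∈M : y ∈ᴸ M
      y∈M = ∈ₑ⇒∈ᴸ y∈
      z∈N : z ∈ᴸ N
      z∈N = ∈ₑ⇒∈ᴸ z∈
      from-dec : Dec (x ≡ v) → Avoid Γ v y z
      from-dec (yes refl) =
        lobe-avoid y∈M p∈M y≢v p≢x ◅◅ p⇝q ◅◅ lobe-avoid q∈N z∈N q≢x z≢v
      from-dec (no x≢v) = lobe-avoid y∈M x∈M y≢v x≢v ◅◅ lobe-avoid x∈N z∈N x≢v z≢v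

  lobes-share-two : x ≢ y → x ∈ᴸ M → y ∈ᴸ M → x ∈ᴸ N → y ∈ᴸ N → M ≅ᴸ N
  lobes-share-two x≢y x∈M y∈M x∈N y∈N =
    lobes-unseparated x∈M y∈M (x≢y ∘ sym) x∈N y∈N (x≢y ∘ sym) ε

  module Isos {Λ₀ : Graph} (σ : LobeIsos Λ₀ Γ) where
    open LobeIsos σ

    image : Lobe Γ → V Λ₀ → V Γ
    image M u = value (to (iso M) u)

    image∈ᴸ : ∀ M u → image M u ∈ᴸ M
    image∈ᴸ M u with to (iso M) u
    ... | _ , [ x∈ ] with recompute em x∈
    -- Membership in the vertex set of a lobe is an irrelevant proof; its witness was recovered by
    -- excluded middle.
    ... | e , M≅e , x∈e = mk e ⟨ M≅e ⟩ x∈e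

    image-surjective : x ∈ᴸ M → ∃[ u ] image M u ≡ x
    image-surjective {M = M} (mk e ⟨ M≅e ⟩ x∈e) =
      from (iso M) (_ , [ x∈ ]) ,
      cong value (_≃_.strictlyInverseˡ (iso M) (_ , [ x∈ ]))
      where x∈ = e , M≅e , x∈e

    image-injective : ∀ M {u w} → image M u ≡ image M w → u ≡ w
    image-injective M {u} {w} eq =
      trans (sym (_≃_.strictlyInverseʳ (iso M) u))
        (trans (cong (from (iso M)) (value-injective eq)) (_≃_.strictlyInverseʳ (iso M) w))

    image-Adj : ∀ M {u w} → Adj Λ₀ u w → Adj Γ (image M u) (image M w)
    image-Adj M {u} {w} a with Equivalence.to (_≃_.adj (iso M) {u} {w}) a
    ... | e , _ , j = Joins-Adj e j

    image-Adj⁻ : M ≅ᴸ e → ∀ {u w} → Joins e (image M u) (image M w) → Adj Λ₀ u w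
    image-Adj⁻ {M} {e} ⟨ M≅e ⟩ j = Equivalence.from (_≃_.adj (iso M)) (e , M≅e , j)

    image-resp : M ≅ᴸ N → ∀ u → image M u ≡ image N u
    image-resp {M} {N} M≅N = resp {M} {N} (≅ᴸ⇒≈ M≅N)

module Transposition (em : ExcludedMiddle 0ℓ) {A : Set} (a b : A) where

  transpose : A → A
  transpose x with em {x ≡ a} | em {x ≡ b}
  ... | yes _ | _     = b
  ... | no _  | yes _ = a
  ... | no _  | no _  = x

  transpose-first : transpose a ≡ b
  transpose-first with em {a ≡ a} | em {a ≡ b}
  ... | yes _ | _ = refl
  ... | no a≢a | _ = contradiction refl a≢a

  transpose-involutive : ∀ x → transpose (transpose x) ≡ x
  transpose-involutive x with em {x ≡ a} | em {x ≡ b}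
  transpose-involutive x | yes refl | _ with em {b ≡ a} | em {b ≡ b}
  ... | yes eq | _ = eq
  ... | no _ | yes _ = refl
  ... | no _ | no b≢b = contradiction refl b≢b
  transpose-involutive x | no _ | yes refl = transpose-first
  transpose-involutive x | no x≢a | no x≢b with em {x ≡ a} | em {x ≡ b}
  ... | yes eq | _ = contradiction eq x≢a
  ... | no _ | yes eq = contradiction eq x≢b
  ... | no _ | no _ = refl

  transpose-preserves : {B : Set} (f : A → B) → f a ≡ f b →
                        ∀ x → f (transpose x) ≡ f x
  transpose-preserves f eq x with em {x ≡ a} | em {x ≡ b}
  ... | yes refl | _ = sym eq
  ... | no _ | yes refl = eq
  ... | no _ | no _ = refl

module Amalgamation
  (em : ExcludedMiddle 0ℓ) (Λ₀ : Graph) (bic : Biconnected Λ₀)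
  (H : Pred (Aut Λ₀) 0ℓ) (H-sub : IsSubgroup H)
  (J : Set) (Q : J → Pred (V Λ₀) 0ℓ) (Q-orbits : IsOrbitFamily H Q)
  (K : Set) (R : K → Pred (V Λ₀) 0ℓ) (R-partition : IsPartition R)
  (Q⊆R : ∀ j → ∃[ k ] Q j ⊆ R k)
  (μ : K → J → Cardinal)
  (μ-support : ∀ k j → (μ k j ≢ fin 0) ⇔ (Q j ⊆ R k)) where

  open IsSubgroup H-sub
  open IsOrbitFamily Q-orbits
  open IsPartition R-partition

  -- Orbits, classes and slots

  jOf : V Λ₀ → J
  jOf u = proj₁ (everyOrbit u)

  kOf : V Λ₀ → K
  kOf u = proj₁ (covers u)

  rep : J → V Λ₀
  rep j = proj₁ (isOrbit j)

  ∈Q-jOf : ∀ u → u ∈ Q (jOf u)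
  ∈Q-jOf u = proj₂ (proj₂ (everyOrbit u)) (idᴬ , id∈ , refl)

  rep∈Q : ∀ j → rep j ∈ Q j
  rep∈Q j = proj₂ (proj₂ (isOrbit j)) (idᴬ , id∈ , refl)

  Q-transitive : ∀ {j u w} → u ∈ Q j → w ∈ Q j → ∃[ h ] h ∈ H × to h u ≡ w
  Q-transitive {j} u∈ w∈ with isOrbit j
  ... | v , Q⊆ , _ with Q⊆ u∈ | Q⊆ w∈
  ... | g , g∈ , refl | h , h∈ , refl =
    (h ∘ᴬ (g ⁻¹ᴬ)) , ∘∈ {g ⁻¹ᴬ} {h} h∈ (⁻¹∈ {g} g∈) ,
    cong (to h) (_≃_.strictlyInverseʳ g v)

  Q-closed : ∀ {j u h} → h ∈ H → u ∈ Q j → to h u ∈ Q j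
  Q-closed {j} {u} {h} h∈ u∈ with isOrbit j
  ... | v , Q⊆ , ⊆Q with Q⊆ u∈
  ... | g , g∈ , refl = ⊆Q ((h ∘ᴬ g) , ∘∈ {g} {h} h∈ g∈ , refl)

  Q-disjoint : ∀ {i j u} → u ∈ Q i → u ∈ Q j → i ≡ j
  Q-disjoint u∈i u∈j = distinct (one u∈i u∈j , one u∈j u∈i)
    where
    one : ∀ {i j u} → u ∈ Q i → u ∈ Q j → Q i ⊆ Q j
    one u∈i u∈j w∈ with Q-transitive u∈i w∈
    ... | h , h∈ , refl = Q-closed {h = h} h∈ u∈j

  kOf-unique : ∀ {k u} → u ∈ R k → kOf u ≡ k
  kOf-unique {u = u} u∈ = disjoint (proj₂ (covers u)) u∈

  -- The places for lobes at a vertex of class k: their number is the sum of μ k j over all j.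
  Slot : K → Set
  Slot k = Σ[ j ∈ J ] ⟦ μ k j ⟧

  -- A single occupied slot determines the class, since a nonzero μ k j puts the whole orbit inside
  -- R k.
  slot-kOf : ∀ {k j u} → ⟦ μ k j ⟧ → u ∈ Q j → kOf u ≡ k
  slot-kOf {k} {j} m u∈ = kOf-unique (Equivalence.to (μ-support k j) (inhabited m) u∈)

  -- The orbit of u lies in the class of u, so its multiplicity there is nonzero. Which slot of this
  -- orbit is taken does not matter.
  home : ∀ u → Slot (kOf u)
  home u with Q⊆R (jOf u)
  ... | k , Q⊆ = jOf u , inhabitant _ (Equivalence.from (μ-support _ _)
    (subst (λ k → Q (jOf u) ⊆ R k) (sym (kOf-unique (Q⊆ (∈Q-jOf u)))) Q⊆))

  home-jOf : ∀ u → proj₁ (home u) ≡ jOf u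
  home-jOf u with Q⊆R (jOf u)
  ... | _ = refl

  HasTypes : ∀ {Γ} → LobeIsos Λ₀ Γ → Set
  HasTypes σ = ∀ v → ∃[ k ] (∀ j → HasCardinality (lobesAt σ v (Q j)) (μ k j))

  -- The tree of copies of Λ₀

  module Tree where

    Λ₀-connected : Connected Λ₀
    Λ₀-connected = proj₁ (proj₂ bic)

    neighbour : ∀ u → ∃[ w ] Adj Λ₀ u w
    neighbour u = from-other (em {u ≡ proj₁ (proj₁ bic)})
      where
      first-step : ∀ {u w} → Star (Adj Λ₀) u w → u ≢ w → ∃[ w ] Adj Λ₀ u w
      first-step ε u≢u = contradiction refl u≢u
      first-step (a ◅ _) _ = _ , a
      from-other : Dec (u ≡ proj₁ (proj₁ bic)) → ∃[ w ] Adj Λ₀ u w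
      from-other (yes refl) = first-step (Λ₀-connected u _) (proj₂ (proj₂ (proj₁ bic)))
      from-other (no u≢)    = first-step (Λ₀-connected u _) u≢

    -- The lobes and the vertices of the tree-like graph.  Each lobe is a copy of
    -- Λ₀; `child x s` hangs at x, glued at the vertex `rep (proj₁ s)` of Λ₀.
    -- The slot `home` of a vertex stands for the lobe in which it is created.
    data Code : Set
    data Vertex : Set
    label : Vertex → V Λ₀
    Fresh : Code → V Λ₀ → Set

    data Code where
      base  : Code
      child : (x : Vertex) (s : Slot (kOf (label x))) → .(s ≢ home (label x)) → Code

    data Vertex where
      vtx : (ℓ : Code) (u : V Λ₀) → .(Fresh ℓ u) → Vertex

    label (vtx _ u _) = u

    Fresh base          u = ⊤
    Fresh (child _ s _) u = u ≢ rep (proj₁ s)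

    private variable
      ℓ ℓ′ c : Code
      u w : V Λ₀
      x y z : Vertex

    -- The embedding of Λ₀ as copy ℓ. The gluing vertex keeps the name it received in the parent
    -- copy, so that each vertex has one name only.
    place : Code → V Λ₀ → Vertex
    place base u = vtx base u tt
    place (child x s n) u with em {u ≡ rep (proj₁ s)}
    ... | yes _ = x
    ... | no u≢ = vtx (child x s n) u u≢

    place-rep : ∀ x s .n → place (child x s n) (rep (proj₁ s)) ≡ x
    place-rep x s n with em {rep (proj₁ s) ≡ rep (proj₁ s)}
    ... | yes _ = refl
    ... | no ≢ = contradiction refl ≢

    place-fresh : ∀ ℓ u .(n : Fresh ℓ u) → place ℓ u ≡ vtx ℓ u n
    place-fresh base u n = refl
    place-fresh (child x s _) u n with em {u ≡ rep (proj₁ s)}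
    ... | yes eq = ⊥-elim-irr (n eq)
    ... | no _ = refl

    place-injective : ∀ ℓ → place ℓ u ≡ place ℓ w → u ≡ w
    place-injective base refl = refl
    place-injective {u} {w} (child x s _) eq
      with em {u ≡ rep (proj₁ s)} | em {w ≡ rep (proj₁ s)}
    ... | yes p | yes q = trans p (sym q)
    place-injective (child x s _) refl | no _ | no _ = refl
    place-injective (child x s _) () | yes _ | no _
    place-injective (child x s _) () | no _ | yes _

    place⁻ : ∀ ℓ {u c w} .{n : Fresh c w} → place ℓ u ≡ vtx c w n →
             (ℓ ≡ c × u ≡ w) ⊎
             (Σ[ s ∈ Slot (kOf w) ] Σ[ s≢ ∈ s ≢ home w ]
                ℓ ≡ child (vtx c w n) s s≢ × u ≡ rep (proj₁ s))
    place⁻ base refl = inj₁ (refl , refl)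
    place⁻ (child x s s≢) {u} eq with em {u ≡ rep (proj₁ s)}
    place⁻ (child x s s≢) refl | yes p = inj₂ (s , recompute em s≢ , refl , p)
    place⁻ (child x s s≢) refl | no _ = inj₁ (refl , refl)

    AdjT : Vertex → Vertex → Set
    AdjT x y = Σ[ ℓ ∈ Code ] Σ[ u ∈ V Λ₀ ] Σ[ w ∈ V Λ₀ ]
               Adj Λ₀ u w × place ℓ u ≡ x × place ℓ w ≡ y

    T : Graph
    T = record
      { V = Vertex
      ; Adj = AdjT
      ; Adj-sym = λ (ℓ , u , w , a , p , q) → ℓ , w , u , Adj-sym Λ₀ a , q , p
      ; Adj-irr = λ (ℓ , u , w , a , p , q) → Adj-irr Λ₀
          (subst (Adj Λ₀ u) (place-injective ℓ (trans q (sym p))) a)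
      }

    copy-Adj : ∀ ℓ {u w} → Adj Λ₀ u w → AdjT (place ℓ u) (place ℓ w)
    copy-Adj ℓ a = ℓ , _ , _ , a , refl , refl

    copy-connected : ∀ ℓ u w → Star AdjT (place ℓ u) (place ℓ w)
    copy-connected ℓ u w = gmap (place ℓ) (copy-Adj ℓ) (Λ₀-connected u w)

    vtx-connected : ∀ ℓ u .(n : Fresh ℓ u) w → Star AdjT (vtx ℓ u n) (place base w)
    place-connected : ∀ ℓ u w → Star AdjT (place ℓ u) (place base w)
    vtx-connected ℓ u n w =
      subst (λ x → Star AdjT x (place base w)) (place-fresh ℓ u n) (place-connected ℓ u w)
    place-connected base u w = copy-connected base u w
    place-connected (child x@(vtx ℓ v m) s n) u w =
      copy-connected (child x s n) u (rep (proj₁ s)) ◅◅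
      subst (λ x → Star AdjT x (place base w)) (sym (place-rep x s n)) (vtx-connected ℓ v m w)

    T-connected : Connected T
    T-connected (vtx ℓ u n) (vtx ℓ′ w m) =
      vtx-connected ℓ u n u ◅◅ reverse (Adj-sym T) (vtx-connected ℓ′ w m u)

    open Lobes em T T-connected

    -- The lobes of the tree are its copies

    code : Edge T → Code
    code e = proj₁ (isAdj e)

    copyEdge : ∀ ℓ {u w} → Adj Λ₀ u w → Edge T
    copyEdge ℓ a = record { isAdj = copy-Adj ℓ a }

    end-in-copy : (e : Edge T) → x ∈ₑ e → ∃[ u ] place (code e) u ≡ x
    end-in-copy e x∈ with isAdj e | x∈
    ... | _ , u , w , _ , p , q | inj₁ refl = u , p
    ... | _ , u , w , _ , p , q | inj₂ refl = w , q

    -- `Under c ℓ` places ℓ in the subtree hanging from c, with c included; `Underᵛ` asks the same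
    -- of the copy in which a vertex is created.
    Under  : Code → Code → Set
    Underᵛ : Code → Vertex → Set
    Under c base = base ≡ c
    Under c (child x s n) = child x s n ≡ c ⊎ Underᵛ c x
    Underᵛ c (vtx ℓ _ _) = Under c ℓ

    Under-refl : ∀ ℓ → Under ℓ ℓ
    Under-refl base = refl
    Under-refl (child _ _ _) = inj₁ refl

    depth : Code → ℕ
    depth base = 0
    depth (child (vtx ℓ _ _) _ _) = suc (depth ℓ)

    Under-depth : ∀ ℓ → Under c ℓ → ℓ ≡ c ⊎ depth c < depth ℓ
    Under-depth base refl = inj₁ refl
    Under-depth (child x s n) (inj₁ eq) = inj₁ eq
    Under-depth (child (vtx ℓ _ _) s n) (inj₂ un) with Under-depth ℓ un
    ... | inj₁ refl = inj₂ (n<1+n _)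
    ... | inj₂ lt = inj₂ (<-trans lt (n<1+n _))

    Under-antisym : Under ℓ ℓ′ → Under ℓ′ ℓ → ℓ ≡ ℓ′
    Under-antisym {ℓ} {ℓ′} p q with Under-depth ℓ′ p | Under-depth ℓ q
    ... | inj₁ eq | _ = sym eq
    ... | inj₂ _ | inj₁ eq = eq
    ... | inj₂ lt | inj₂ gt = contradiction (<-trans lt gt) (<-irrefl refl)

    module _ {x s} .{n : s ≢ home (label x)} where

      private
        C : Code
        C = child x s n

      Underᵛ⇒Under : ∀ ℓ → Underᵛ C (place ℓ u) → Under C ℓ
      Underᵛ⇒Under base un = un
      Underᵛ⇒Under {u} (child _ s′ _) un with em {u ≡ rep (proj₁ s′)}
      ... | yes _ = inj₂ un
      ... | no _ = un

      -- The attaching vertex x is the only vertex that copies of the subtree share with the rest.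
      Under⇒Underᵛ : ∀ ℓ → place ℓ u ≢ x → Under C ℓ → Underᵛ C (place ℓ u)
      Under⇒Underᵛ base _ un = un
      Under⇒Underᵛ {u} (child _ s′ _) ≢x un with em {u ≡ rep (proj₁ s′)}
      Under⇒Underᵛ (child _ s′ _) ≢x (inj₁ refl) | yes _ = contradiction refl ≢x
      Under⇒Underᵛ (child _ s′ _) ≢x (inj₂ un)   | yes _ = un
      ... | no _ = un

      -- Each edge stays inside one copy, so a walk can leave the subtree at x only.
      Underᵛ-Avoid : Avoid T x y z → Underᵛ C y → Underᵛ C z
      Underᵛ-Avoid ε un = un
      Underᵛ-Avoid (((ℓ , u , w , _ , refl , refl) , _ , ≢x) ◅ p) un =
        Underᵛ-Avoid p (Under⇒Underᵛ ℓ ≢x (Underᵛ⇒Under ℓ un))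

      ~⇒Under : ∀ {e f : Edge T} → e ~ f → code f ≡ C → Under C (code e)
      ~⇒Under {e} {f} e~f refl with Classical.other-end em e x | Classical.other-end em f x
      ... | y , y∈ , y≢x | z , z∈ , z≢x with end-in-copy e y∈ | end-in-copy f z∈
      ... | u , refl | w , refl = Underᵛ⇒Under (code e)
        (Underᵛ-Avoid (Avoid-sym T (e~f x y∈ z∈ y≢x z≢x))
                      (Under⇒Underᵛ (code f) z≢x (Under-refl (code f))))

    Under-base : ∀ ℓ → Under base ℓ
    Under-base base = refl
    Under-base (child (vtx ℓ _ _) _ _) = inj₂ (Under-base ℓ)

    ~⇒Under-code : ∀ {e f : Edge T} → e ~ f → Under (code f) (code e)
    ~⇒Under-code {e} {f} e~f = go (code f) refl
      where
      go : ∀ c → code f ≡ c → Under c (code e)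
      go base _ = Under-base (code e)
      go (child x s n) eq = ~⇒Under {x} {s} {n} {e} {f} e~f eq

    -- Unseparated edges lie in each other's subtrees, and ancestry is antisymmetric.
    ≅⇒code≡ : ∀ {e f} → e ≅ᴸ f → code e ≡ code f
    ≅⇒code≡ {e} {f} e≅f = Under-antisym
      (~⇒Under-code {f} {e} (≅ᴸ⇒~ (≅ᴸ-sym e≅f))) (~⇒Under-code {e} {f} (≅ᴸ⇒~ e≅f))

    -- A vertex outside the copy does no harm to it; a vertex inside is the image of some t, and Λ₀
    -- - t is connected.
    copy-avoid : ∀ ℓ v u w → place ℓ u ≢ v → place ℓ w ≢ v →
                 Avoid T v (place ℓ u) (place ℓ w)
    copy-avoid ℓ v u w u≢ w≢ with em {∃[ t ] place ℓ t ≡ v}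
    ... | no none = gmap (place ℓ)
          (λ a → copy-Adj ℓ a , (λ p → none (_ , p)) , (λ p → none (_ , p)))
          (Λ₀-connected u w)
    ... | yes (t , refl) = gmap (place ℓ ∘ value)
          (λ {y} {z} a → copy-Adj ℓ a , ≢t y , ≢t z)
          (proj₂ (proj₂ bic) t (u , [ u≢ ∘ cong (place ℓ) ]) (w , [ w≢ ∘ cong (place ℓ) ]))
      where
      ≢t : (y : V (Λ₀ - t)) → place ℓ (value y) ≢ place ℓ t
      ≢t (_ , [ y≢t ]) eq = recompute em y≢t (place-injective ℓ eq)

    code≡⇒≅ : ∀ {e f} → code e ≡ code f → e ≅ᴸ f
    code≡⇒≅ {e} {f} eq = ~⇒≅ᴸ e~f
      where
      e~f : e ~ f
      e~f v x∈ y∈ x≢v y≢v with end-in-copy e x∈ | end-in-copy f y∈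
      ... | u , refl | w , refl rewrite eq = copy-avoid (code f) v u w x≢v y≢v

    someEdge : Code → Edge T
    someEdge ℓ = copyEdge ℓ (proj₂ (neighbour (proj₁ (proj₁ bic))))

    T-isos : LobeIsos Λ₀ T
    T-isos = record
      { iso = λ Λ → record
          { bij = injective∧surjective⇒Inverse (put Λ)
              (λ eq → place-injective (code Λ) (cong value eq)) (put-surjective Λ)
          ; adj = λ {u} {w} → mk⇔
              (λ a → copyEdge (code Λ) a
                   , unwrap (code≡⇒≅ {Λ} {copyEdge (code Λ) a} refl) , inj₁ (refl , refl))
              (λ (e , Λ≅e , j) → joined Λ e (≅⇒code≡ {Λ} {e} ⟨ Λ≅e ⟩) j)
          }
      ; resp = λ {Λ} {Λ′} Λ≈Λ′ u → cong (λ ℓ → place ℓ u) (≅⇒code≡ (≈⇒≅ᴸ {Λ} {Λ′} Λ≈Λ′))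
      }
      where
      put : ∀ Λ → V Λ₀ → V (lobeGraph T Λ)
      put Λ u = place (code Λ) u ,
        [ e , unwrap (code≡⇒≅ {Λ} {e} refl) , inj₁ refl ]
        where
        e : Edge T
        e = copyEdge (code Λ) (proj₂ (neighbour u))

      value-≡ : ∀ {Λ} {y z : V (lobeGraph T Λ)} → value y ≡ value z → y ≡ z
      value-≡ {y = _ , _} refl = refl

      put-surjective : ∀ Λ x → ∃[ u ] put Λ u ≡ x
      put-surjective Λ (x , [ x∈ ]) = found (recompute em x∈)
        where
        found : ∃[ e ] Λ ≅ e × x ∈ₑ e → ∃[ u ] put Λ u ≡ (x , [ x∈ ])
        found (e , Λ≅e , x∈e) = proj₁ end , value-≡ {Λ}
          (trans (cong (λ ℓ → place ℓ (proj₁ end)) (≅⇒code≡ {Λ} {e} ⟨ Λ≅e ⟩)) (proj₂ end))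
          where
          end : ∃[ u ] place (code e) u ≡ x
          end = end-in-copy e x∈e

      joined : ∀ Λ e → code Λ ≡ code e → ∀ {u w} →
               Joins e (place (code Λ) u) (place (code Λ) w) → Adj Λ₀ u w
      joined Λ e eq {u} {w} j = from-ends j (isAdj e) eq
        where
        from-ends : ∀ {ℓ y z} →
                    (y ≡ place ℓ u × z ≡ place ℓ w) ⊎ (y ≡ place ℓ w × z ≡ place ℓ u) →
                    (a : AdjT y z) → ℓ ≡ proj₁ a → Adj Λ₀ u w
        from-ends {ℓ} (inj₁ (p , q)) (_ , _ , _ , a , p′ , q′) refl =
          subst₂ (Adj Λ₀) (place-injective ℓ (trans p′ p)) (place-injective ℓ (trans q′ q)) a
        from-ends {ℓ} (inj₂ (p , q)) (_ , _ , _ , a , p′ , q′) refl =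
          Adj-sym Λ₀ (subst₂ (Adj Λ₀)
            (place-injective ℓ (trans p′ p)) (place-injective ℓ (trans q′ q)) a)

    -- The correspondence between slots at v and copies through v, from which the multiplicities at
    -- v are read off.
    lobeCode : ∀ v → Slot (kOf (label v)) → Code
    lobeCode v@(vtx ℓ u n) s with em {s ≡ home u}
    ... | yes _ = ℓ
    ... | no s≢ = child v s s≢

    lobeCode-position : ∀ v s → ∃[ u ] u ∈ Q (proj₁ s) × place (lobeCode v s) u ≡ v
    lobeCode-position v@(vtx ℓ u n) s with em {s ≡ home u}
    ... | yes refl = u , subst (λ j → u ∈ Q j) (sym (home-jOf u)) (∈Q-jOf u) , place-fresh ℓ u n
    ... | no s≢ = rep (proj₁ s) , rep∈Q _ , place-rep v s s≢

    lobeCode-injective : ∀ v s t → lobeCode v s ≡ lobeCode v t → s ≡ t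
    lobeCode-injective v@(vtx ℓ u n) s t eq with em {s ≡ home u} | em {t ≡ home u}
    ... | yes p | yes q = trans p (sym q)
    lobeCode-injective (vtx ℓ u n) s t () | yes _ | no _
    lobeCode-injective (vtx ℓ u n) s t () | no _ | yes _
    lobeCode-injective (vtx ℓ u n) s t refl | no _ | no _ = refl

    lobeCode-surjective : ∀ v ℓ {u j} → place ℓ u ≡ v → u ∈ Q j →
                          ∃[ s ] lobeCode v s ≡ ℓ × proj₁ s ≡ j
    lobeCode-surjective (vtx ℓ u n) ℓ′ p u∈ with place⁻ ℓ′ p
    ... | inj₁ (refl , refl) = home u , is-ℓ , trans (home-jOf u) (Q-disjoint (∈Q-jOf u) u∈)
      where
      is-ℓ : lobeCode (vtx ℓ u n) (home u) ≡ ℓ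
      is-ℓ with em {home u ≡ home u}
      ... | yes _ = refl
      ... | no ≢ = contradiction refl ≢
    ... | inj₂ (s , s≢ , refl , refl) = s , is-child , Q-disjoint (rep∈Q _) u∈
      where
      is-child : lobeCode (vtx ℓ u n) s ≡ child (vtx ℓ u n) s s≢
      is-child with em {s ≡ home u}
      ... | yes eq = contradiction eq s≢
      ... | no _ = refl

    T-types : HasTypes T-isos
    T-types v = kOf (label v) , λ j → injective∧surjective⇒Inverse {S = lobesAt T-isos v (Q j)}
      (lobe j) (inj j) (surj j)
      where
      lobe : ∀ j → ⟦ μ (kOf (label v)) j ⟧ → Setoid.Carrier (lobesAt T-isos v (Q j))
      lobe j m with lobeCode-position v (j , m)
      ... | u , u∈ , p = someEdge (lobeCode v (j , m)) , u , u∈ , p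

      slot-injective : ∀ {j} {m m′ : ⟦ μ (kOf (label v)) j ⟧} →
                       _≡_ {A = Slot (kOf (label v))} (j , m) (j , m′) → m ≡ m′
      slot-injective refl = refl

      inj : ∀ j {m m′} → Setoid._≈_ (lobesAt T-isos v (Q j)) (lobe j m) (lobe j m′) → m ≡ m′
      inj j {m} {m′} eq = slot-injective (lobeCode-injective v _ _
        (≅⇒code≡ {someEdge _} {someEdge _} (≈⇒≅ᴸ eq)))

      surj : ∀ j y → ∃[ m ] Setoid._≈_ (lobesAt T-isos v (Q j)) (lobe j m) y
      surj j (e , u , u∈ , p) with lobeCode-surjective v (code e) p u∈
      ... | (_ , m) , eq , refl = m , ≅ᴸ⇒≈ (code≡⇒≅ {someEdge _} {e} eq)

    T-countable : Countable Λ₀ → Countable T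
    T-countable (κ , enum) = Counting.cardinality em encᵛ encᵛ-injective
      where
      ι : V Λ₀ → ℕ
      ι = ⟦⟧→ℕ κ ∘ Inverse.from enum

      ι-injective : ι u ≡ ι w → u ≡ w
      ι-injective {u} {w} eq = trans (sym (Inverse.strictlyInverseˡ enum u))
        (trans (cong (Inverse.to enum) (⟦⟧→ℕ-injective κ eq)) (Inverse.strictlyInverseˡ enum w))

      encˢ : ∀ {k} → Slot k → ℕ
      -- An orbit is encoded by its representative, since the enumeration at hand is one of vertices
      -- and orbits are disjoint.
      encˢ {k} (j , m) = pair (ι (rep j)) (⟦⟧→ℕ (μ k j) m)

      encˢ-injective : ∀ {k} (s t : Slot k) → encˢ s ≡ encˢ t → s ≡ t
      encˢ-injective {k} (i , m) (j , m′) eq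
        with pair-injective (ι (rep i)) _ {ι (rep j)} eq
      ... | p , q with Q-disjoint (rep∈Q i) (subst (_∈ Q j) (sym (ι-injective p)) (rep∈Q j))
      ... | refl = cong (i ,_) (⟦⟧→ℕ-injective (μ k i) q)

      encᶜ : Code → ℕ
      encᵛ : Vertex → ℕ
      encᶜ base = 0
      encᶜ (child x s _) = suc (pair (encᵛ x) (encˢ s))
      encᵛ (vtx ℓ u _) = pair (encᶜ ℓ) (ι u)

      encᶜ-injective : ∀ c ℓ → encᶜ c ≡ encᶜ ℓ → c ≡ ℓ
      encᵛ-injective : ∀ {x y} → encᵛ x ≡ encᵛ y → x ≡ y
      encᶜ-injective base base eq = refl
      encᶜ-injective (child x s _) (child y t _) eq
        with pair-injective (encᵛ x) (encˢ s) {encᵛ y} {encˢ t} (suc-injective eq)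
      ... | p , q with encᵛ-injective {x} {y} p
      ... | refl with encˢ-injective s t q
      ... | refl = refl
      encᵛ-injective {vtx ℓ u _} {vtx ℓ′ w _} eq
        with pair-injective (encᶜ ℓ) (ι u) {encᶜ ℓ′} {ι w} eq
      ... | p , q with encᶜ-injective ℓ ℓ′ p | ι-injective q
      ... | refl | refl = refl

    another : ∀ u → ∃[ w ] w ≢ u
    another u with neighbour u
    ... | w , a = w , λ { refl → Adj-irr Λ₀ a }

    -- A second slot at a base vertex of class k carries a child copy, and that vertex cuts the
    -- child off from the base.
    T-connectivity1 : (∃[ k ] (Fin 2 ↣ Slot k)) → HasConnectivity1 T
    T-connectivity1 (k , two) = nontrivial , T-connected , v , cut
      where
      inR : ∃[ u ] u ∈ R k
      inR = IsPartition.nonempty R-partition k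
      v₀ : V Λ₀
      v₀ = proj₁ inR
      v : Vertex
      v = vtx base v₀ tt
      not-home : ∀ (h : Slot k) → ∃[ s ] s ≢ h
      not-home h with em {Injection.to two zero ≡ h}
      ... | no ≢h = _ , ≢h
      ... | yes refl = Injection.to two (suc zero) , λ eq →
        contradiction (Injection.injective two eq) λ ()
      s : Σ[ s ∈ Slot (kOf v₀) ] s ≢ home v₀
      s with kOf v₀ | kOf-unique {k} (proj₂ inR) | home v₀
      ... | _ | refl | h = not-home h
      C : Code
      C = child v (proj₁ s) (proj₂ s)
      p q : Vertex
      p = vtx base (proj₁ (another v₀)) tt
      q = vtx C (proj₁ off-root) (proj₂ off-root)
        where off-root = another (rep (proj₁ (proj₁ s)))
      nontrivial : NonTrivial T
      nontrivial = p , q , λ ()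
      p≢v : p ≢ v
      p≢v eq = proj₂ (another v₀) (cong label eq)
      q≢v : q ≢ v
      q≢v ()
      cut : ¬ (NonTrivial (T - v) × Connected (T - v))
      -- A walk from q to p in T - v would keep p in the subtree of C, but p is created in the base
      -- copy.
      cut (_ , conn) = contradiction
        (Underᵛ-Avoid (gmap value (λ {a} {b} adj → adj , ≢v a , ≢v b)
          (conn (q , [ q≢v ]) (p , [ p≢v ]))) (inj₁ refl)) λ ()
        where
        ≢v : (a : V (T - v)) → value a ≢ v
        ≢v (_ , [ a≢v ]) = recompute em a≢v

  open Tree

  -- Charts and their continuation across a vertex

  module Extension (Γ : Graph) (conn : Connected Γ)
                   (σ : LobeIsos Λ₀ Γ) (types : HasTypes σ) where
    open Lobes em Γ conn
    open Isos σ

    -- A parametrisation of a lobe by Λ₀, in the coset of H of the given one.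
    record Chart : Set where
      field
        lobe  : Lobe Γ
        twist : Aut Λ₀
        ∈H    : twist ∈ H

    open Chart

    chart : Chart → V Λ₀ → V Γ
    chart E u = image (lobe E) (to (twist E) u)

    module _ (E : Chart) (u : V Λ₀) where

      private
        y : V Γ
        y = chart E u

        twisted∈ : to (twist E) u ∈ Q (jOf u)
        twisted∈ = Q-closed {h = twist E} (∈H E) (∈Q-jOf u)

        -- The lobe of E is itself counted at y under the orbit of u, so the class that `types`
        -- assigns to y has a slot of this orbit.
        k≡ : kOf u ≡ proj₁ (types y)
        k≡ = slot-kOf {u = u}
          (Inverse.from (proj₂ (types y) (jOf u)) (lobe E , _ , twisted∈ , refl)) (∈Q-jOf u)

        card : ∀ j → HasCardinality (lobesAt σ y (Q j)) (μ (kOf u) j)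
        card = subst (λ k → ∀ j → HasCardinality (lobesAt σ y (Q j)) (μ k j))
                     (sym k≡) (proj₂ (types y))

        θ : (s : Slot (kOf u)) → Setoid.Carrier (lobesAt σ y (Q (proj₁ s)))
        θ (j , m) = Inverse.to (card j) m

        θ-lobe : Slot (kOf u) → Lobe Γ
        θ-lobe = proj₁ ∘ θ

        index : ∀ {j} → Setoid.Carrier (lobesAt σ y (Q j)) → ⟦ μ (kOf u) j ⟧
        index {j} = Inverse.from (card j)

        θ-index : ∀ {j} (w : Setoid.Carrier (lobesAt σ y (Q j))) →
                  θ-lobe (j , index w) ≅ᴸ proj₁ w
        θ-index {j} w = ≈⇒≅ᴸ (Inverse.strictlyInverseˡ (card j) w)

        -- A lobe through y fixes the coordinate of y in it, hence the orbit, hence the slot: no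
        -- lobe is counted under two orbits.
        index-cong : ∀ {i j} (w : Setoid.Carrier (lobesAt σ y (Q i)))
                     (w′ : Setoid.Carrier (lobesAt σ y (Q j))) →
                     proj₁ w ≅ᴸ proj₁ w′ → _≡_ {A = Slot (kOf u)} (i , index w) (j , index w′)
        index-cong {i} {j} (M , v , v∈ , p) (N , v′ , v′∈ , p′) M≅N =
          same-vertex (image-injective N (trans (sym (image-resp M≅N v)) (trans p (sym p′))))
                      v∈ p p′
          where
          same-orbit : ∀ {i} → i ≡ j →
                       (v∈ : v′ ∈ Q i) (p : image M v′ ≡ y) (p′ : image N v′ ≡ y) →
                       _≡_ {A = Slot (kOf u)}
                         (i , index (M , v′ , v∈ , p)) (j , index (N , v′ , v′∈ , p′))
          same-orbit refl v∈ p p′ = cong (j ,_)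
            (Inverse.from-cong (card j) {M , v′ , v∈ , p} {N , v′ , v′∈ , p′} (≅ᴸ⇒≈ M≅N))
          same-vertex : ∀ {v} → v ≡ v′ →
                        (v∈ : v ∈ Q i) (p : image M v ≡ y) (p′ : image N v′ ≡ y) →
                        _≡_ {A = Slot (kOf u)}
                          (i , index (M , v , v∈ , p)) (j , index (N , v′ , v′∈ , p′))
          same-vertex refl v∈ = same-orbit (Q-disjoint v∈ v′∈) v∈

        index-θ : ∀ (s : Slot (kOf u)) → (proj₁ s , index (θ s)) ≡ s
        index-θ (j , m) = cong (j ,_) (Inverse.strictlyInverseʳ (card j) m)

        θ-injective : ∀ {s t} → θ-lobe s ≅ᴸ θ-lobe t → s ≡ t
        θ-injective {s} {t} eq =
          trans (sym (index-θ s)) (trans (index-cong (θ s) (θ t) eq) (index-θ t))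

        θ-surjective : ∀ {M v j} → image M v ≡ y → v ∈ Q j →
                       ∃[ s ] proj₁ s ≡ j × θ-lobe s ≅ᴸ M
        θ-surjective {M} {v} {j} p v∈ = (j , index w) , refl , θ-index w
          where
          w : Setoid.Carrier (lobesAt σ y (Q j))
          w = M , v , v∈ , p

        here : ∃[ s ] proj₁ s ≡ jOf u × θ-lobe s ≅ᴸ lobe E
        here = θ-surjective {lobe E} refl twisted∈

        -- Both slots belong to the orbit of u, so the swap leaves every slot in its orbit.
        exchange : Slot (kOf u) → Slot (kOf u)
        exchange = Transposition.transpose em (home u) (proj₁ here)

        exchange-involutive : ∀ s → exchange (exchange s) ≡ s
        exchange-involutive = Transposition.transpose-involutive em (home u) (proj₁ here)

        -- θ, corrected so that the slot `home u` gives the lobe of E itself.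
        Θ : Slot (kOf u) → Lobe Γ
        Θ s = θ-lobe (exchange s)

        Θ-element : ∀ s → ∃[ w ] w ∈ Q (proj₁ s) × image (Θ s) w ≡ y
        Θ-element s = w , subst (λ j → w ∈ Q j) same-j w∈ , p
          where
          w = proj₁ (proj₂ (θ (exchange s)))
          w∈ = proj₁ (proj₂ (proj₂ (θ (exchange s))))
          p = proj₂ (proj₂ (proj₂ (θ (exchange s))))
          same-j : proj₁ (exchange s) ≡ proj₁ s
          same-j = Transposition.transpose-preserves em (home u) (proj₁ here) proj₁
            (trans (home-jOf u) (sym (proj₁ (proj₂ here)))) s

        -- T glues the child at `rep`, whereas y has some other coordinate of the same orbit in the
        -- new lobe; h makes up the difference.
        coset : ∀ s → ∃[ h ] h ∈ H × to h (rep (proj₁ s)) ≡ proj₁ (Θ-element s)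
        coset s = Q-transitive (rep∈Q (proj₁ s)) (proj₁ (proj₂ (Θ-element s)))

      abstract

        extend : Slot (kOf u) → Chart
        extend s = record
          { lobe = Θ s ; twist = proj₁ (coset s) ; ∈H = proj₁ (proj₂ (coset s)) }

        extend-rep : ∀ s → chart (extend s) (rep (proj₁ s)) ≡ chart E u
        extend-rep s = trans (cong (image (Θ s)) (proj₂ (proj₂ (coset s))))
                             (proj₂ (proj₂ (Θ-element s)))

        extend-injective : ∀ s t → lobe (extend s) ≅ᴸ lobe (extend t) → s ≡ t
        extend-injective s t eq =
          trans (sym (exchange-involutive s))
            (trans (cong exchange (θ-injective eq)) (exchange-involutive t))

        extend-home : lobe (extend (home u)) ≅ᴸ lobe E
        extend-home = subst (λ s → θ-lobe s ≅ᴸ lobe E)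
          (sym (Transposition.transpose-first em (home u) (proj₁ here))) (proj₂ (proj₂ here))

        extend-surjective : ∀ {M} → chart E u ∈ᴸ M → ∃[ s ] lobe (extend s) ≅ᴸ M
        extend-surjective {M} y∈ = back
          (θ-surjective {M} (proj₂ (image-surjective y∈))
                            (∈Q-jOf (proj₁ (image-surjective y∈))))
          where
          back : ∀ {j} → ∃[ s ] proj₁ s ≡ j × θ-lobe s ≅ᴸ M →
                 ∃[ s ] lobe (extend s) ≅ᴸ M
          back (s , _ , eq) = exchange s ,
            subst (λ s → θ-lobe s ≅ᴸ M) (sym (exchange-involutive s)) eq

    -- The map from the tree onto Γ

    module Developing (M₀ : Lobe Γ) where

      private variable
        M : Lobe Γ
        b p q v y z : V Γ

      τ : Code → Chart
      τ base = record { lobe = M₀ ; twist = idᴬ ; ∈H = IsSubgroup.id∈ H-sub }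
      τ (child (vtx ℓ u _) s _) = extend (τ ℓ) u s

      develop : Vertex → V Γ
      develop (vtx ℓ u _) = chart (τ ℓ) u

      L : Code → Lobe Γ
      L = lobe ∘ τ

      develop-place : ∀ ℓ u → develop (place ℓ u) ≡ chart (τ ℓ) u
      develop-place base u = refl
      develop-place (child (vtx ℓ w _) s _) u with em {u ≡ rep (proj₁ s)}
      ... | yes refl = sym (extend-rep (τ ℓ) w s)
      ... | no _ = refl

      chart∈ᴸ : ∀ ℓ u → chart (τ ℓ) u ∈ᴸ L ℓ
      chart∈ᴸ ℓ u = image∈ᴸ (L ℓ) _

      chart-injective : ∀ ℓ {u w} → chart (τ ℓ) u ≡ chart (τ ℓ) w → u ≡ w
      chart-injective ℓ {u} {w} eq =
        trans (sym (_≃_.strictlyInverseʳ h u))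
          (trans (cong (from h) (image-injective (L ℓ) eq)) (_≃_.strictlyInverseʳ h w))
        where h = twist (τ ℓ)

      chart-surjective : ∀ ℓ → y ∈ᴸ L ℓ → ∃[ u ] chart (τ ℓ) u ≡ y
      chart-surjective ℓ y∈ with image-surjective y∈
      ... | u , refl = from h u , cong (image (L ℓ)) (_≃_.strictlyInverseˡ h u)
        where h = twist (τ ℓ)

      attach∈ᴸ : ∀ x s .(n : s ≢ home (label x)) → develop x ∈ᴸ L (child x s n)
      attach∈ᴸ x@(vtx ℓ u _) s n = subst (_∈ᴸ L (child x s n)) (extend-rep (τ ℓ) u s)
        (chart∈ᴸ (child x s n) (rep (proj₁ s)))

      -- Every lobe at a vertex in the image occupies a slot: `home` gives the copy of x itself, any
      -- other slot a child.
      lobe-at : ∀ x → develop x ∈ᴸ M → ∃[ ℓ ] L ℓ ≅ᴸ M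
      lobe-at {M} x@(vtx ℓ u _) y∈ = from-slot (extend-surjective (τ ℓ) u y∈)
        where
        from-slot : ∃[ s ] lobe (extend (τ ℓ) u s) ≅ᴸ M → ∃[ ℓ ] L ℓ ≅ᴸ M
        from-slot (s , eq) = from-dec em
          where
          from-dec : Dec (s ≡ home u) → ∃[ ℓ ] L ℓ ≅ᴸ M
          from-dec (yes s≡) = ℓ , ≅ᴸ-trans (≅ᴸ-sym (extend-home (τ ℓ) u))
            (subst (λ s → lobe (extend (τ ℓ) u s) ≅ᴸ M) s≡ eq)
          from-dec (no s≢) = child x s s≢ , eq

      preimages : ∀ x (e : Edge Γ) → develop x ∈ₑ e →
                  ∃[ ℓ ] L ℓ ≅ᴸ e × (∀ {y} → y ∈ₑ e → ∃[ u ] chart (τ ℓ) u ≡ y)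
      preimages x e x∈ = ℓ , eq , λ y∈ → chart-surjective ℓ (∈ᴸ-resp (≅ᴸ-sym eq) (∈ₑ⇒∈ᴸ y∈))
        where
        at-x : ∃[ ℓ ] L ℓ ≅ᴸ e
        at-x = lobe-at x (∈ₑ⇒∈ᴸ x∈)
        ℓ : Code
        ℓ = proj₁ at-x
        eq : L ℓ ≅ᴸ e
        eq = proj₂ at-x

      -- Walks lift: the lobe of an edge leaving the image is the image of a copy, so the far end is
      -- reached too.
      develop-surjective : ∀ y → ∃[ x ] develop x ≡ y
      develop-surjective y = follow o (conn (develop o) y)
        where
        o : Vertex
        o = vtx base (proj₁ (proj₁ bic)) tt
        follow : ∀ x → Star (Adj Γ) (develop x) z → ∃[ x ] develop x ≡ z
        next-at : ∀ {y} → ∃[ x ] develop x ≡ y → Star (Adj Γ) y z → ∃[ x ] develop x ≡ z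
        follow x ε = x , refl
        follow x (a ◅ w) = next-at
          (place ℓ (proj₁ target) , trans (develop-place ℓ _) (proj₂ target)) w
          where
          found = preimages x (record { isAdj = a }) (inj₁ refl)
          ℓ = proj₁ found
          target = proj₂ (proj₂ found) (inj₂ refl)
        next-at (x , refl) w = follow x w

      -- Every vertex on the walk is reached from b in Γ - v, so p is not among them.
      avoid-unreached : Avoid Γ v b q → ¬ Avoid Γ v b p → Avoid Γ p b q
      avoid-unreached ε _ = ε
      avoid-unreached (s@(a , _) ◅ w) ¬p =
        (a , (λ { refl → ¬p ε }) , (λ { refl → ¬p (s ◅ ε) })) ◅
        avoid-unreached w (λ w′ → ¬p (s ◅ w′))

      child≇parent : ∀ ℓ u .(n : Fresh ℓ u) s .(m : s ≢ home u) →
                     ¬ L (child (vtx ℓ u n) s m) ≅ᴸ L ℓ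
      child≇parent ℓ u n s m eq = recompute em m
        (extend-injective (τ ℓ) u s (home u) (≅ᴸ-trans eq (≅ᴸ-sym (extend-home (τ ℓ) u))))

      -- The attaching vertex of a child lobe separates the rest of that lobe
      -- from the base lobe.
      gate : ∀ x s .(n : s ≢ home (label x)) → b ∈ᴸ M₀ → p ∈ᴸ L (child x s n) →
             p ≢ develop x → ¬ Avoid Γ (develop x) b p × Avoid Γ p b (develop x)
      -- The entry q is b for the base lobe and otherwise the attaching vertex of ℓ, which the gate
      -- one level down already reaches; the two statements are proved by a joint descent to the
      -- base.
      reach-parent : ∀ ℓ u .(n : Fresh ℓ u) → b ∈ᴸ M₀ → b ≢ chart (τ ℓ) u →
                     ∃[ q ] q ∈ᴸ L ℓ × q ≢ chart (τ ℓ) u × Avoid Γ (chart (τ ℓ) u) b q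

      gate {b} {p} x@(vtx ℓ u m) s n b∈ p∈ p≢x = from-dec em
        where
        from-path : ∃[ q ] q ∈ᴸ L ℓ × q ≢ develop x × Avoid Γ (develop x) b q →
                    ¬ Avoid Γ (develop x) b p × Avoid Γ p b (develop x)
        -- The walk to q misses p because p is out of reach; the parent lobe then leads from q to
        -- the attaching vertex without p.
        from-path (q , q∈ , q≢x , b⇝q) = ¬b⇝p , avoid-unreached b⇝q ¬b⇝p ◅◅
          lobe-avoid q∈ (chart∈ᴸ ℓ u) (λ { refl → ¬b⇝p b⇝q }) (p≢x ∘ sym)
          where
          ¬b⇝p : ¬ Avoid Γ (develop x) b p
          -- Otherwise child and parent, which meet at `develop x`, would also be joined away from
          -- it and coincide.
          ¬b⇝p b⇝p = child≇parent ℓ u m s n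
            (lobes-unseparated (attach∈ᴸ x s n) p∈ p≢x (chart∈ᴸ ℓ u) q∈ q≢x
              (Avoid-sym Γ b⇝p ◅◅ b⇝q))

        from-dec : Dec (b ≡ develop x) →
                   ¬ Avoid Γ (develop x) b p × Avoid Γ p b (develop x)
        from-dec (yes refl) = (λ { ε → p≢x refl ; ((_ , x≢x , _) ◅ _) → x≢x refl }) , ε
        from-dec (no b≢x)   = from-path (reach-parent ℓ u m b∈ b≢x)

      reach-parent {b} base u _ b∈ b≢ = b , b∈ , b≢ , ε
      reach-parent {b} ℓ@(child x@(vtx ℓ′ w m) s n) u fresh b∈ b≢ =
        develop x , attach∈ᴸ x s n , ≢ ∘ sym ,
        proj₂ (gate x s n b∈ (chart∈ᴸ ℓ u) ≢)
        where
        ≢ : chart (τ ℓ) u ≢ develop x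
        ≢ eq = recompute em fresh
          (chart-injective ℓ (trans eq (sym (extend-rep (τ ℓ′) w s))))

      -- An end of the common lobe away from the gate could serve as both b and p, joined by the
      -- empty walk.
      base≇child : ∀ x s .(n : s ≢ home (label x)) → ¬ M₀ ≅ᴸ L (child x s n)
      base≇child x s n eq = proj₁ (gate x s n (∈ᴸ-resp (≅ᴸ-sym eq) p∈) p∈ p≢x) ε
        where
        end = Classical.other-end em (L (child x s n)) (develop x)
        p∈ : proj₁ end ∈ᴸ L (child x s n)
        p∈ = ∈ₑ⇒∈ᴸ (proj₁ (proj₂ end))
        p≢x : proj₁ end ≢ develop x
        p≢x = proj₂ (proj₂ end)

      -- Each is the lobe at this vertex on the side of the base lobe.
      parents-agree : ∀ ℓ u ℓ′ w .(n : Fresh ℓ u) .(m : Fresh ℓ′ w) →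
                      chart (τ ℓ) u ≡ chart (τ ℓ′) w → L ℓ ≅ᴸ L ℓ′
      parents-agree ℓ u ℓ′ w n m eq = meet
        (reach-parent ℓ u n b∈ b≢) (reach-parent ℓ′ w m b∈ (λ b≡ → b≢ (trans b≡ (sym eq))))
        where
        end = Classical.other-end em M₀ (chart (τ ℓ) u)
        b₀ : V Γ
        b₀ = proj₁ end
        b∈ : b₀ ∈ᴸ M₀
        b∈ = ∈ₑ⇒∈ᴸ (proj₁ (proj₂ end))
        b≢ : b₀ ≢ chart (τ ℓ) u
        b≢ = proj₂ (proj₂ end)
        Reach : Code → V Γ → Set
        Reach ℓ y = ∃[ q ] q ∈ᴸ L ℓ × q ≢ y × Avoid Γ y b₀ q
        meet : Reach ℓ (chart (τ ℓ) u) → Reach ℓ′ (chart (τ ℓ′) w) → L ℓ ≅ᴸ L ℓ′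
        meet (q , q∈ , q≢ , b⇝q) (q′ , q′∈ , q′≢ , b⇝q′) =
          lobes-unseparated (chart∈ᴸ ℓ u) q∈ q≢
            (subst (_∈ᴸ L ℓ′) (sym eq) (chart∈ᴸ ℓ′ w)) q′∈ (λ q′≡ → q′≢ (trans q′≡ eq))
            (Avoid-sym Γ b⇝q ◅◅ subst (λ v → Avoid Γ v b₀ q′) (sym eq) b⇝q′)

      -- Two distinct gates would both lie in the common lobe. The gate at x is then reached from
      -- the base without the gate at y, which the latter forbids.
      gates-agree : ∀ x s .(n : s ≢ home (label x)) y t .(m : t ≢ home (label y)) →
                    L (child x s n) ≅ᴸ L (child y t m) → develop x ≡ develop y
      gates-agree x s n y t m eq = from-dec em
        where
        src∈ : src M₀ ∈ᴸ M₀
        src∈ = ∈ₑ⇒∈ᴸ (inj₁ refl)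
        from-dec : Dec (develop x ≡ develop y) → develop x ≡ develop y
        from-dec (yes x≡y) = x≡y
        from-dec (no x≢y) = contradiction
          (proj₂ (gate x s n src∈ (∈ᴸ-resp (≅ᴸ-sym eq) (attach∈ᴸ y t m)) (x≢y ∘ sym)))
          (proj₁ (gate y t m src∈ (∈ᴸ-resp eq (attach∈ᴸ x s n)) x≢y))

      -- Equal vertices have equal parent lobes, and equal lobes have equal gates, which are
      -- vertices nearer the base; hence the joint induction.
      develop-injective : ∀ x y → develop x ≡ develop y → x ≡ y
      L-injective : ∀ c ℓ → L c ≅ᴸ L ℓ → c ≡ ℓ

      develop-injective (vtx ℓ u n) (vtx ℓ′ w m) eq =
        same-lobe (L-injective ℓ ℓ′ (parents-agree ℓ u ℓ′ w n m eq)) n m eq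
        where
        same-lobe : ∀ {ℓ ℓ′ u w} → ℓ ≡ ℓ′ → .(n : Fresh ℓ u) .(m : Fresh ℓ′ w) →
                    chart (τ ℓ) u ≡ chart (τ ℓ′) w → vtx ℓ u n ≡ vtx ℓ′ w m
        same-lobe {ℓ} refl n m eq = same-label (chart-injective ℓ eq) n m
          where
          same-label : ∀ {u w} → u ≡ w → .(n : Fresh ℓ u) .(m : Fresh ℓ w) →
                       vtx ℓ u n ≡ vtx ℓ w m
          same-label refl _ _ = refl

      L-injective base base _ = refl
      L-injective base (child x s n) eq = contradiction eq (base≇child x s n)
      L-injective (child x s n) base eq = contradiction (≅ᴸ-sym eq) (base≇child x s n)
      L-injective (child x s n) (child y t m) eq =
        same-gate (develop-injective x y (gates-agree x s n y t m eq)) s t n m eq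
        where
        same-gate : ∀ {x y} → x ≡ y →
                    ∀ s t .(n : s ≢ home (label x)) .(m : t ≢ home (label y)) →
                    L (child x s n) ≅ᴸ L (child y t m) → child x s n ≡ child y t m
        same-gate {vtx ℓ u f} refl s t n m eq = same-slot (extend-injective (τ ℓ) u s t eq) n m
          where
          same-slot : ∀ {s t} → s ≡ t → .(n : s ≢ home u) .(m : t ≢ home u) →
                      child (vtx ℓ u f) s n ≡ child (vtx ℓ u f) t m
          same-slot refl _ _ = refl

      chart-Adj : ∀ ℓ {u w} → Adj Λ₀ u w → Adj Γ (chart (τ ℓ) u) (chart (τ ℓ) w)
      chart-Adj ℓ a = image-Adj (L ℓ) (Equivalence.to (_≃_.adj (twist (τ ℓ))) a)

      development : T ≃ Γ
      development = record
        { bij = injective∧surjective⇒Inverse develop (develop-injective _ _) develop-surjective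
        ; adj = mk⇔ preserves reflects
        }
        where
        preserves : ∀ {x y} → AdjT x y → Adj Γ (develop x) (develop y)
        preserves (ℓ , u , w , a , refl , refl) =
          subst₂ (Adj Γ) (sym (develop-place ℓ u)) (sym (develop-place ℓ w)) (chart-Adj ℓ a)

        reflects : ∀ {x y} → Adj Γ (develop x) (develop y) → AdjT x y
        reflects {x} {y} a = ℓ , proj₁ u , proj₁ w ,
          Equivalence.from (_≃_.adj (twist (τ ℓ)))
            (image-Adj⁻ (proj₁ (proj₂ found)) (inj₁ (sym (proj₂ u) , sym (proj₂ w)))) ,
          develop-injective _ x (trans (develop-place ℓ _) (proj₂ u)) ,
          develop-injective _ y (trans (develop-place ℓ _) (proj₂ w))
          where
          found = preimages x (record { isAdj = a }) (inj₁ refl)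
          ℓ = proj₁ found
          u = proj₂ (proj₂ found) (inj₁ refl)
          w = proj₂ (proj₂ found) (inj₂ refl)

      base∈ᴸ : ∀ u → develop (vtx base u tt) ∈ᴸ M₀
      base∈ᴸ u = chart∈ᴸ base u

      base-surjective : y ∈ᴸ M₀ → ∃[ u ] develop (vtx base u tt) ≡ y
      base-surjective = chart-surjective base

    -- Developing T from M and from N gives an automorphism of Γ that takes the vertices of M into
    -- N. The images of the two ends of M then lie in N, and two common vertices identify a lobe.
    lobe-transitive : LobeTransitive Γ
    lobe-transitive M N = φ , ≅ᴸ⇒≈ {mapEdge φ M} {N} (lobes-share-two (src≢tgt (mapEdge φ M))
        (∈ₑ⇒∈ᴸ (inj₁ refl)) (∈ₑ⇒∈ᴸ (inj₂ refl))
        (φ-end (∈ₑ⇒∈ᴸ (inj₁ refl))) (φ-end (∈ₑ⇒∈ᴸ (inj₂ refl))))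
      where
      f g : T ≃ Γ
      f = Developing.development M
      g = Developing.development N
      φ : Aut Γ
      φ = ≃-trans (≃-sym f) g
      φ-end : ∀ {y} → y ∈ᴸ M → to φ y ∈ᴸ N
      φ-end {y} y∈ = subst (λ y → to φ y ∈ᴸ N) (proj₂ found)
        (subst (_∈ᴸ N) (cong (to g) (sym (_≃_.strictlyInverseʳ f (vtx base (proj₁ found) tt))))
          (Developing.base∈ᴸ N (proj₁ found)))
        where
        found : ∃[ u ] to f (vtx base u tt) ≡ y
        found = Developing.base-surjective M y∈

  -- Existence and uniqueness

  edge-exists : ∀ {Γ} → NonTrivial Γ → Connected Γ → Edge Γ
  edge-exists {Γ} (x , y , x≢y) conn = first-step (conn x y) x≢y
    where
    first-step : ∀ {x y} → Star (Adj Γ) x y → x ≢ y → Edge Γ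
    first-step ε x≢x = contradiction refl x≢x
    first-step (a ◅ _) _ = record { isAdj = a }

  existence-uniqueness : Countable Λ₀ → (∃[ k ] (Fin 2 ↣ Slot k)) →
    ∃! _≃_ λ Γ → Countable Γ × HasConnectivity1 Γ × LobeTransitive Γ ×
                 Σ[ σ ∈ LobeIsos Λ₀ Γ ] HasTypes σ
  existence-uniqueness countable two =
    T , (T-countable countable , T-connectivity1 two ,
         Extension.lobe-transitive T T-connected T-isos T-types ,
         T-isos , T-types) ,
    -- Any lobe of the competitor can serve as M₀, so the lobe of an arbitrary edge is taken.
    λ {Γ} (_ , (nontrivial , conn , _) , _ , σ , types) →
      Extension.Developing.development Γ conn σ types (edge-exists nontrivial conn)

theorem3p5 : ExcludedMiddle 0ℓ →
    (Λ₀ : Graph) → Countable Λ₀ → Biconnected Λ₀ →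
    (H : Pred (Aut Λ₀) 0ℓ) → IsSubgroup H →
    (J : Set) (Q : J → Pred (V Λ₀) 0ℓ) → IsOrbitFamily H Q →
    (K : Set) (R : K → Pred (V Λ₀) 0ℓ) → IsPartition R →
    (∀ j → ∃[ k ] Q j ⊆ R k) →
    (μ : K → J → Cardinal) →
    (∀ k j → (μ k j ≢ fin 0) ⇔ (Q j ⊆ R k)) →
    (∃[ k ] (Fin 2 ↣ (Σ[ j ∈ J ] ⟦ μ k j ⟧))) →
    ∃! _≃_ λ Γ →
    Countable Γ × HasConnectivity1 Γ × LobeTransitive Γ ×
    (Σ[ σ ∈ LobeIsos Λ₀ Γ ]
    (∀ v → ∃[ k ] (∀ j → HasCardinality (lobesAt σ v (Q j)) (μ k j))))
theorem3p5 em Λ₀ countable bic H H-sub J Q Q-orbits K R R-partition Q⊆R μ μ-support two =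
  Amalgamation.existence-uniqueness em Λ₀ bic H H-sub J Q Q-orbits K R R-partition
    Q⊆R μ μ-support countable two
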